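{- Let $x$ be an indeterminate. Then, for all integers $n\geq1$, $$\det_{0\leq i,j\le n-1}\left(4^i \binom{x+i+2j+1}{2j+1} + \binom{x-i+2j+1}{2j+1}\right) =2\prod_{i=1}^n \frac{2^{2i-1} \, 3^{i-1} \, \Gamma(i) \, \Gamma\bigl(\frac{3i+x}{2}\bigr)}{\Gamma(2i) \, \Gamma\bigl(\frac{i+x}{2}\bigr)}=2^{\binom {n+1}2+1}3^{\binom n2}\prod _{i=1} ^{n}\frac {i!} {(2i)!}\prod _{i=0} ^{n-1}(x+3i+1)_{n-i}.$$
   Context: The binomial coefficient is $\binom{\alpha}{p}=\frac{\alpha(\alpha-1)\cdots(\alpha-p+1)}{p!}$ if $p\ge 0$ is an integer, and $0$ if $p<0$. The Pochhammer symbol is $(\alpha)_p=\alpha(\alpha+1)\cdots(\alpha+p-1)$ for $p\ge1$ and $(\alpha)_0=1$. The quotients of Gamma functions are understood as the rational functions of $x$ obtained by simplifying using $\Gamma(z+1)=z\Gamma(z)$. -}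

module Defs where

open import Algebra.Bundles.Raw using (RawRing)
import Algebra.Definitions.RawSemiring as RawSemiringDefs
open import Data.Fin.Base using (Fin; zero; suc; toℕ)
open import Data.Integer.Base as ℤ using (ℤ; -[1+_]) renaming (+_ to pos)
import Data.Integer.Properties as ℤ
open import Data.List.Base as List using (List; []; _∷_)
open import Data.Nat.Base as ℕ using (ℕ; zero; suc; pred; NonZero; _!)
import Data.Nat.Properties as ℕ
open import Data.Rational.Base as ℚ using (ℚ; 0ℚ; 1ℚ; ½)
import Data.Rational.Properties as ℚ
open import Data.Rational.Solver using (module +-*-Solver)
import Data.Rational.Unnormalised.Base as ℚᵘ
import Data.Rational.Unnormalised.Properties as ℚᵘ
open import Data.Vec.Functional using (Vector; head; tail; map; removeAt)
open import Level using (Level; 0ℓ)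
open import Relation.Binary.PropositionalEquality

module Determinant {c ℓ : Level} (R : RawRing c ℓ) where
  open RawRing R
  open RawSemiringDefs rawSemiring using (sum; _^_)

  -- Laplace expansion along the first row.
  det : ∀ {n : ℕ} → Vector (Vector Carrier n) n → Carrier
  det {zero}  M = 1#
  det {suc n} M =
    sum (λ j → (- 1#) ^ toℕ j * head M j * det (map (λ row → removeAt row j) (tail M)))

-- The list a₀ ∷ a₁ ∷ … ∷ aₘ ∷ [] stands for a₀ + a₁ x + … + aₘ xᵐ.
-- Trailing zeros are allowed, so the equality of polynomials is _≈ₚ_.
ℚ[x] : Set
ℚ[x] = List ℚ

coeff : ℚ[x] → ℕ → ℚ
coeff []      _       = 0ℚ
coeff (a ∷ _) zero    = a
coeff (_ ∷ p) (suc k) = coeff p k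

infix 4 _≈ₚ_
record _≈ₚ_ (p q : ℚ[x]) : Set where
  constructor mk≈
  field
    coeff-≡ : ∀ k → coeff p k ≡ coeff q k

_+ₚ_ : ℚ[x] → ℚ[x] → ℚ[x]
[]      +ₚ q       = q
(a ∷ p) +ₚ []      = a ∷ p
(a ∷ p) +ₚ (b ∷ q) = (a ℚ.+ b) ∷ (p +ₚ q)

_*ₚ_ : ℚ[x] → ℚ[x] → ℚ[x]
[]      *ₚ q = []
(a ∷ p) *ₚ q = List.map (a ℚ.*_) q +ₚ (0ℚ ∷ (p *ₚ q))

ℚ[x]-rawRing : RawRing 0ℓ 0ℓ
ℚ[x]-rawRing = record
  { Carrier = ℚ[x]
  ; _≈_     = _≈ₚ_
  ; _+_     = _+ₚ_
  ; _*_     = _*ₚ_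
  ; -_      = List.map (λ a → ℚ.- a)
  ; 0#      = []
  ; 1#      = 1ℚ ∷ []
  }

open RawRing ℚ[x]-rawRing public using (_≈_; _+_; _*_; -_; 1#)
open RawSemiringDefs (RawRing.rawSemiring ℚ[x]-rawRing) public using (product)
open Determinant ℚ[x]-rawRing public using (det)

infixl 6 _-_
_-_ : ℚ[x] → ℚ[x] → ℚ[x]
p - q = p + (- q)

x : ℚ[x]
x = 0ℚ ∷ 1ℚ ∷ []

const : ℚ → ℚ[x]
const a = a ∷ []

fromℕ : ℕ → ℚ
fromℕ m = pos m ℚ./ 1

⌜_⌝ : ℕ → ℚ[x]
⌜ m ⌝ = const (fromℕ m)

infixl 8 _/2
_/2 : ℚ[x] → ℚ[x]
p /2 = const ½ * p

infix 8 _!/_!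
_!/_! : ℕ → ℕ → ℚ
m !/ n ! = pos (m !) ℚ./ (n !)
  where instance _ = n ℕ.!≢0

binom : ℚ[x] → ℤ → ℚ[x]
binom α (pos p)  = const (0 !/ p !) * product {p} (λ k → α - ⌜ toℕ k ⌝)
binom α -[1+ _ ] = ⌜ 0 ⌝

poch : ℚ[x] → ℕ → ℚ[x]
poch α p = product {p} (λ k → α + ⌜ toℕ k ⌝)

-- Γ(m)/Γ(n) for positive integers, where Γ(m) = (m - 1)!.
Γ-quotientℕ : (m n : ℕ) .{{_ : NonZero m}} .{{_ : NonZero n}} → ℚ
Γ-quotientℕ m n = pred m !/ pred n !

-- Γ(w)/Γ(z) when w = z + k with k a natural number: applying
-- Γ(z + 1) = z Γ(z) repeatedly gives Γ(z + k) = (z)ₖ Γ(z), so that the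
-- quotient is a polynomial.
Γ-quotient : (w z : ℚ[x]) (k : ℕ) → .(w ≈ z + ⌜ k ⌝) → ℚ[x]
Γ-quotient w z k _ = poch z k

fromℕ-+ : ∀ m n → fromℕ (m ℕ.+ n) ≡ fromℕ m ℚ.+ fromℕ n
fromℕ-+ m n = ℚ.toℚᵘ-injective (begin
  ℚ.toℚᵘ (fromℕ (m ℕ.+ n))                   ≈⟨ ℚ.toℚᵘ-fromℚᵘ (pos (m ℕ.+ n) ℚᵘ./ 1) ⟩
  pos (m ℕ.+ n) ℚᵘ./ 1                       ≈⟨ ℚᵘ.*≡* (cong (ℤ._* pos 1) (sym (cong₂ ℤ._+_ (ℤ.*-identityʳ (pos m)) (ℤ.*-identityʳ (pos n))))) ⟩
  (pos m ℚᵘ./ 1) ℚᵘ.+ (pos n ℚᵘ./ 1)         ≈⟨ ℚᵘ.+-cong (ℚ.toℚᵘ-fromℚᵘ (pos m ℚᵘ./ 1)) (ℚ.toℚᵘ-fromℚᵘ (pos n ℚᵘ./ 1)) ⟨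
  ℚ.toℚᵘ (fromℕ m) ℚᵘ.+ ℚ.toℚᵘ (fromℕ n)     ≈⟨ ℚ.toℚᵘ-homo-+ (fromℕ m) (fromℕ n) ⟨
  ℚ.toℚᵘ (fromℕ m ℚ.+ fromℕ n)               ∎)
  where open ℚᵘ.≃-Reasoning

[3i+x]/2≈[i+x]/2+i : ∀ i → (⌜ 3 ℕ.* i ⌝ + x) /2 ≈ (⌜ i ⌝ + x) /2 + ⌜ i ⌝
[3i+x]/2≈[i+x]/2+i i = mk≈ λ where
    zero    → constantTerm
    (suc k) → refl
  where
  a = fromℕ i

  3i : fromℕ (3 ℕ.* i) ≡ a ℚ.+ (a ℚ.+ (a ℚ.+ 0ℚ))
  3i = trans (fromℕ-+ i _) (cong (a ℚ.+_)
         (trans (fromℕ-+ i _) (cong (a ℚ.+_) (fromℕ-+ i 0))))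

  constantTerm : ½ ℚ.* (fromℕ (3 ℕ.* i) ℚ.+ 0ℚ) ℚ.+ 0ℚ ≡ (½ ℚ.* (a ℚ.+ 0ℚ) ℚ.+ 0ℚ) ℚ.+ a
  constantTerm = trans (cong (λ t → ½ ℚ.* (t ℚ.+ 0ℚ) ℚ.+ 0ℚ) 3i)
    (solve 1 (λ t →
        con ½ :* ((t :+ (t :+ (t :+ con 0ℚ))) :+ con 0ℚ) :+ con 0ℚ
          := (con ½ :* (t :+ con 0ℚ) :+ con 0ℚ) :+ t)
      refl a)
    where open +-*-Solver

{-# OPTIONS --safe #-}
module Submission where

-- Put u = 4/(1 - t), v = 1 - t and a = x + 1.  The (i, j) entry is the coefficient of t^(2j+1) in
-- (uⁱ + vⁱ) (1 - t)⁻ᵃ.  Since u v = 4, uⁱ + vⁱ is a monic polynomial of degree i (for i = 0: the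
-- constant 2) in u + v - 5 = t (3 + t)/(1 - t), so row operations reduce the determinant to 2 D n a,
-- where D n a is the determinant of the odd coefficients of
--   yᵢ = (t (3 + t)/(1 - t))ⁱ (1 - t)⁻ᵃ.
-- With Rᵢ = (3 + 2t - t²) yᵢ/(1 - t) one has
--   (3 + t²) yᵢ′ + 2 a t yᵢ = (i + a) Rᵢ + 3 i Rᵢ₋₁,
-- and Rᵢ₊₁ is t (1 - t²) (9 - t²) times yᵢ with a replaced by a + 3.  Comparing even coefficients,
-- all the operators involved are triangular, which gives
--   ∏ 3 (2j + 1) · D (n + 1) a = ∏ (a + i) · 3 · 9ⁿ · D n (a + 3).
-- The identities between polynomials in x are obtained by evaluating x at all rational numbers.

import Algebra.Definitions.RawSemiring as RawSemiringDefs
import Algebra.Properties.CommutativeMonoid.Sum as CommutativeMonoidSum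
import Algebra.Properties.CommutativeSemigroup as CommutativeSemigroupProperties
import Algebra.Properties.Group as GroupProperties
import Algebra.Properties.Semiring.Sum as SemiringSum
import Algebra.Solver.Ring as RingSolver
import Relation.Binary.Reasoning.Setoid as SetoidReasoning
open import Algebra.Bundles using (CommutativeRing)
open import Algebra.Bundles.Raw using (RawRing)
open import Algebra.Solver.Ring.AlmostCommutativeRing using (_-Raw-AlmostCommutative⟶_; fromCommutativeRing)
open import Data.Fin.Base as Fin using (Fin; zero; suc; toℕ; punchIn)
import Data.Fin.Properties as Fin
open import Data.Integer.Base as ℤ using () renaming (+_ to pos)
import Data.Integer.Properties as ℤ
import Data.List.Base as List
open import Data.Maybe.Base as Maybe using ()
open import Data.Nat.Base as ℕ using (ℕ; zero; suc; pred; _≥_; _∸_; _^_; _!; s≤s; z<s; s<s)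
import Data.Nat.Properties as ℕ
open import Data.Product.Base using (_×_; _,_; proj₁; proj₂)
open import Data.Rational.Base as ℚ using (ℚ; 0ℚ; 1ℚ; ½)
import Data.Rational.Properties as ℚ
open import Data.Rational.Solver using (module +-*-Solver)
import Data.Rational.Unnormalised.Base as ℚᵘ
import Data.Rational.Unnormalised.Properties as ℚᵘ
open import Data.Vec.Functional as Functional using (Vector)
open import Function.Base using (_∘_; flip)
open import Level using (0ℓ; _⊔_)
open import Relation.Binary.PropositionalEquality as ≡ using (_≡_; _≢_)
open import Relation.Nullary.Decidable using (dec⇒maybe)
open import Relation.Nullary.Negation using (contradiction)
import Defs
open Defs using (fromℕ; fromℕ-+)

-- The determinant sees only odd coefficients, so every operator used must respect parity. This
-- dictates the shape of the differential equation: both (3 + t²) d/dt and multiplication by 2 a t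
-- send odd series to even ones, and so does multiplication by t (1 - t²) (9 - t²). The equation
-- arises as follows. Write b = u + v - 5. Then b′ = 4/(1 - t)² - 1 = (3 + 2t - t²)/(1 - t)², so Rᵢ
-- = (1 - t) b′ yᵢ. Because (3 + t²)/(1 - t) = 3 + b, differentiating the factor bⁱ of yᵢ
-- contributes i (3 + b) Rᵢ₋₁ = 3 i Rᵢ₋₁ + i Rᵢ. The terms with a contribute a Rᵢ, because 3 + t² +
-- 2t (1 - t) = 3 + 2t - t². The passage from a to a + 3 is the step by which the factors x + 3i + 1
-- of the answer progress. The induction on n therefore has to treat all values of a at once.
-- Evaluation moves the argument to ℚ, where the product of the numbers 3 (2j + 1) can be cancelled.

module DeterminantProperties {c ℓ} (R : CommutativeRing c ℓ) where
  open Functional using (_∷_)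
  open CommutativeRing R hiding (zero)
  open Defs.Determinant rawRing public using (det)
  open RawSemiringDefs (RawRing.rawSemiring rawRing) using (product) renaming (_^_ to _^#_)
  open SemiringSum semiring using (sum; sum-cong-≋; ∑-distrib-+; ∑-comm; *-distribˡ-sum; sum-replicate-zero)
  open GroupProperties +-group using (inverseˡ-unique)
  open CommutativeSemigroupProperties *-commutativeSemigroup using (x∙yz≈y∙xz)
  open SetoidReasoning setoid

  -- Multilinearity and equal columns, over any commutative ring

  Matrix : ℕ → Set c
  Matrix n = Vector (Vector Carrier n) n

  sgn : ∀ {n} → Fin n → Carrier
  sgn j = (- 1#) ^# toℕ j

  minor : ∀ {n} → Matrix (suc n) → Fin (suc n) → Matrix n
  minor M j i k = M (suc i) (punchIn j k)

  sum-zero : ∀ {n} {f : Vector Carrier n} → (∀ i → f i ≈ 0#) → sum f ≈ 0#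
  sum-zero {n} f≈0 = trans (sum-cong-≋ f≈0) (sum-replicate-zero n)

  det-cong : ∀ {n} (M N : Matrix n) → (∀ i j → M i j ≈ N i j) → det M ≈ det N
  det-cong {zero}  M N _   = refl
  det-cong {suc n} M N M≈N = sum-cong-≋ λ j →
    *-cong (*-congˡ {sgn j} (M≈N zero j)) (det-cong (minor M j) (minor N j) λ i k → M≈N (suc i) (punchIn j k))

  -- For r = 0 the entries of the expansion are linear and the minors agree; for a later row the
  -- minors are linear by induction. The combined form covers additivity (a = 1), homogeneity (row r
  -- of P zero) and the addition of a multiple of a row.
  det-linear : ∀ {n} (r : Fin n) (a : Carrier) (M N P : Matrix n) →
    (∀ j → M r j ≈ a * N r j + P r j) →
    (∀ i → i ≢ r → ∀ j → M i j ≈ N i j × M i j ≈ P i j) →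
    det M ≈ a * det N + det P
  det-linear {suc n} r a M N P row others = begin
    det M                                                    ≈⟨ sum-cong-≋ (term r row others) ⟩
    sum (λ j → a * expand N j + expand P j)                  ≈⟨ ∑-distrib-+ (λ j → a * expand N j) (expand P) ⟩
    sum (λ j → a * expand N j) + det P                       ≈⟨ +-congʳ (*-distribˡ-sum a (expand N)) ⟨
    a * det N + det P                                        ∎
    where
    expand : Matrix (suc n) → Fin (suc n) → Carrier
    expand A j = sgn j * A zero j * det (minor A j)

    term : ∀ r → (∀ j → M r j ≈ a * N r j + P r j) →
           (∀ i → i ≢ r → ∀ j → M i j ≈ N i j × M i j ≈ P i j) →
           ∀ j → expand M j ≈ a * expand N j + expand P j
    term zero row others j = begin
      sgn j * M zero j * det (minor M j)
        ≈⟨ *-congʳ (*-congˡ (row j)) ⟩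
      sgn j * (a * N zero j + P zero j) * det (minor M j)
        ≈⟨ *-congʳ (distribˡ _ _ _) ⟩
      (sgn j * (a * N zero j) + sgn j * P zero j) * det (minor M j)
        ≈⟨ distribʳ _ _ _ ⟩
      sgn j * (a * N zero j) * det (minor M j) + sgn j * P zero j * det (minor M j)
        ≈⟨ +-cong (*-cong (x∙yz≈y∙xz _ _ _) (det-cong (minor M j) (minor N j) λ i k → proj₁ (others (suc i) (λ ()) (punchIn j k))))
                  (*-congˡ (det-cong (minor M j) (minor P j) λ i k → proj₂ (others (suc i) (λ ()) (punchIn j k)))) ⟩
      a * (sgn j * N zero j) * det (minor N j) + expand P j
        ≈⟨ +-congʳ (*-assoc _ _ _) ⟩
      a * expand N j + expand P j ∎
    term (suc r) row others j = begin
      sgn j * M zero j * det (minor M j)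
        ≈⟨ *-congˡ (det-linear r a (minor M j) (minor N j) (minor P j) (λ k → row (punchIn j k))
             (λ i i≢r k → others (suc i) (λ { ≡.refl → i≢r ≡.refl }) (punchIn j k))) ⟩
      sgn j * M zero j * (a * det (minor N j) + det (minor P j))
        ≈⟨ distribˡ _ _ _ ⟩
      sgn j * M zero j * (a * det (minor N j)) + sgn j * M zero j * det (minor P j)
        ≈⟨ +-cong (trans (x∙yz≈y∙xz _ _ _) (*-congˡ (*-congʳ (*-congˡ (proj₁ (others zero (λ ()) j))))))
                  (*-congʳ (*-congˡ (proj₂ (others zero (λ ()) j)))) ⟩
      a * expand N j + expand P j ∎

  -- Columns come before rows because the expansion runs along the first row. Deleting column 0 or
  -- column 1 leaves the same minor, so these two terms differ only in sign. Deleting a later column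
  -- keeps the equal pair in front, and induction applies.
  det-equalColumns : ∀ {n} (M : Matrix (suc (suc n))) →
    (∀ i → M i zero ≈ M i (suc zero)) → det M ≈ 0#
  det-equalColumns {n} M M₀≈M₁ = begin
    e₀ + (e₁ + rest)   ≈⟨ +-assoc _ _ _ ⟨
    (e₀ + e₁) + rest   ≈⟨ +-cong e₀+e₁≈0 (rest≈0 n M M₀≈M₁) ⟩
    0# + 0#            ≈⟨ +-identityˡ 0# ⟩
    0#                 ∎
    where
    expand : ∀ {n} → Matrix (suc n) → Fin (suc n) → Carrier
    expand A j = sgn j * A zero j * det (minor A j)
    e₀ = expand M zero
    e₁ = expand M (suc zero)
    rest = sum (λ j → expand M (suc (suc j)))

    minors : ∀ i k → minor M zero i k ≈ minor M (suc zero) i k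
    minors i zero    = sym (M₀≈M₁ (suc i))
    minors i (suc k) = refl

    e₀+e₁≈0 : e₀ + e₁ ≈ 0#
    e₀+e₁≈0 = begin
      1# * M zero zero * det (minor M zero) + - 1# * 1# * M zero (suc zero) * det (minor M (suc zero))
        ≈⟨ +-congˡ (*-cong (*-cong (*-identityʳ _) (sym (M₀≈M₁ zero))) (det-cong (minor M (suc zero)) (minor M zero) λ i k → sym (minors i k))) ⟩
      1# * M zero zero * det (minor M zero) + - 1# * M zero zero * det (minor M zero)
        ≈⟨ distribʳ _ _ _ ⟨
      (1# * M zero zero + - 1# * M zero zero) * det (minor M zero)
        ≈⟨ *-congʳ (distribʳ _ _ _) ⟨
      (1# + - 1#) * M zero zero * det (minor M zero)
        ≈⟨ *-congʳ (trans (*-congʳ (-‿inverseʳ 1#)) (zeroˡ _)) ⟩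
      0# * det (minor M zero)
        ≈⟨ zeroˡ _ ⟩
      0# ∎

    rest≈0 : ∀ n (M : Matrix (suc (suc n))) → (∀ i → M i zero ≈ M i (suc zero)) →
             sum (λ j → expand M (suc (suc j))) ≈ 0#
    rest≈0 zero    M M₀≈M₁ = refl
    rest≈0 (suc n) M M₀≈M₁ = sum-zero λ j →
      trans (*-congˡ {sgn (suc (suc j)) * M zero (suc (suc j))} (det-equalColumns (minor M (suc (suc j))) (λ i → M₀≈M₁ (suc i)))) (zeroʳ _)

  -- Invariance under transposition

  TransposeInvariant : ℕ → Set (c ⊔ ℓ)
  TransposeInvariant n = (M : Matrix n) → det (flip M) ≈ det M

  -- Expanding along the first row and then along the first column gives
  -- an expression symmetric in rows and columns.
  transpose-step : ∀ {n} → TransposeInvariant (suc n) → TransposeInvariant n → TransposeInvariant (suc (suc n))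
  transpose-step {n} det-transpose₁ det-transpose₀ M = sym (begin
    e₀ + sum (λ j → - 1# * sgn j * M zero (suc j) * det (minor M (suc j)))
      ≈⟨ +-cong (*-congˡ (sym (det-transpose₁ (minor M zero)))) (sum-cong-≋ (expandColumn M)) ⟩
    e₀ᵀ + sum (λ j → sum λ i → term M i j)
      ≈⟨ +-congˡ (∑-comm (λ j i → term M i j)) ⟩
    e₀ᵀ + sum (λ i → sum λ j → term M i j)
      ≈⟨ +-congˡ (sum-cong-≋ λ i → sum-cong-≋ λ j → symmetric i j) ⟩
    e₀ᵀ + sum (λ i → sum λ j → term (flip M) j i)
      ≈⟨ +-congˡ (sum-cong-≋ (expandColumn (flip M))) ⟨
    det (flip M) ∎)
    where
    e₀ = 1# * M zero zero * det (minor M zero)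
    e₀ᵀ = 1# * M zero zero * det (minor (flip M) zero)

    core : Matrix (suc (suc n)) → Fin (suc n) → Fin (suc n) → Matrix n
    core A i j k l = A (suc (punchIn i k)) (suc (punchIn j l))

    term : Matrix (suc (suc n)) → Fin (suc n) → Fin (suc n) → Carrier
    term A i j = - 1# * sgn j * A zero (suc j) * (sgn i * A (suc i) zero * det (core A i j))

    expandColumn : ∀ A j →
      - 1# * sgn j * A zero (suc j) * det (minor A (suc j)) ≈ sum (λ i → term A i j)
    expandColumn A j = trans
      (*-congˡ (trans (sym (det-transpose₁ (minor A (suc j))))
                      (sum-cong-≋ λ i → *-congˡ {sgn i * A (suc i) zero} (det-transpose₀ (core A i j)))))
      (*-distribˡ-sum _ (λ i → sgn i * A (suc i) zero * det (core A i j)))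

    swapFactors : ∀ m s a t b d → m * s * a * (t * b * d) ≈ m * t * b * (s * a * d)
    swapFactors m s a t b d = begin
      m * s * a * (t * b * d)      ≈⟨ *-congʳ (*-assoc _ _ _) ⟩
      m * (s * a) * (t * b * d)    ≈⟨ *-assoc _ _ _ ⟩
      m * (s * a * (t * b * d))    ≈⟨ *-congˡ (x∙yz≈y∙xz _ _ _) ⟩
      m * (t * b * (s * a * d))    ≈⟨ *-assoc _ _ _ ⟨
      m * (t * b) * (s * a * d)    ≈⟨ *-congʳ (*-assoc _ _ _) ⟨
      m * t * b * (s * a * d)      ∎

    symmetric : ∀ i j → term M i j ≈ term (flip M) j i
    symmetric i j = trans (swapFactors _ _ _ _ _ _)
      (*-congˡ (*-congˡ (sym (det-transpose₀ (core M i j)))))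

  det-transpose : ∀ n → TransposeInvariant n
  det-transpose zero          = λ _ → refl
  det-transpose (suc zero)    = λ _ → refl
  det-transpose (suc (suc n)) = transpose-step (det-transpose (suc n)) (det-transpose n)

  -- Row operations and triangular factors

  det-equalRows : ∀ {n} (M : Matrix (suc (suc n))) →
    (∀ j → M zero j ≈ M (suc zero) j) → det M ≈ 0#
  det-equalRows M M₀≈M₁ = trans (sym (det-transpose _ M)) (det-equalColumns (flip M) M₀≈M₁)

  -- Polarisation: with `u+v` in both rows the determinant vanishes, and its expansion leaves just
  -- the two mixed terms.
  det-swapRows : ∀ {n} (u v : Vector Carrier (suc (suc n))) (A : Vector (Vector Carrier (suc (suc n))) n) →
    det (u ∷ v ∷ A) ≈ - det (v ∷ u ∷ A)
  det-swapRows u v A = inverseˡ-unique _ _ (begin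
    det (u ∷ v ∷ A) + det (v ∷ u ∷ A)
      ≈⟨ +-cong (first u (det-equalRows (u ∷ u ∷ A) λ _ → refl)) (second v (det-equalRows (v ∷ v ∷ A) λ _ → refl)) ⟩
    det (u ∷ u+v ∷ A) + det (v ∷ u+v ∷ A)
      ≈⟨ +-congʳ (*-identityˡ _) ⟨
    1# * det (u ∷ u+v ∷ A) + det (v ∷ u+v ∷ A)
      ≈⟨ det-linear zero 1# (u+v ∷ u+v ∷ A) (u ∷ u+v ∷ A) (v ∷ u+v ∷ A) (λ j → +-congʳ (sym (*-identityˡ _)))
           (λ { zero z≢z → contradiction ≡.refl z≢z ; (suc zero) _ j → refl , refl ; (suc (suc i)) _ j → refl , refl }) ⟨
    det (u+v ∷ u+v ∷ A)
      ≈⟨ det-equalRows (u+v ∷ u+v ∷ A) (λ _ → refl) ⟩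
    0# ∎)
    where
    u+v : Vector Carrier _
    u+v j = u j + v j

    split : ∀ w → det (w ∷ u+v ∷ A) ≈ 1# * det (w ∷ u ∷ A) + det (w ∷ v ∷ A)
    split w = det-linear (suc zero) 1# (w ∷ u+v ∷ A) (w ∷ u ∷ A) (w ∷ v ∷ A) (λ j → +-congʳ (sym (*-identityˡ _)))
      (λ { zero _ j → refl , refl ; (suc zero) z≢z → contradiction ≡.refl z≢z ; (suc (suc i)) _ j → refl , refl })

    first : ∀ w → det (w ∷ u ∷ A) ≈ 0# → det (w ∷ v ∷ A) ≈ det (w ∷ u+v ∷ A)
    first w eq = sym (trans (split w) (trans (+-congʳ (trans (*-congˡ eq) (zeroʳ _))) (+-identityˡ _)))

    second : ∀ w → det (w ∷ v ∷ A) ≈ 0# → det (w ∷ u ∷ A) ≈ det (w ∷ u+v ∷ A)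
    second w eq = sym (trans (split w) (trans (+-cong (*-identityˡ _) eq) (+-identityʳ _)))

  -- Linearity clears the second row. A swap then puts `u` in second place, where it becomes the
  -- first row of every minor, so induction clears the remaining rows. A second swap restores the
  -- order.
  det-addMultiplesOfFirstRow : ∀ {n} (a : Vector Carrier n) (u : Vector Carrier (suc n))
    (A : Vector (Vector Carrier (suc n)) n) →
    det (u ∷ (λ i j → a i * u j + A i j)) ≈ det (u ∷ A)
  det-addMultiplesOfFirstRow {zero}  a u A = refl
  det-addMultiplesOfFirstRow {suc n} a u A = begin
    det (u ∷ au+A)
      ≈⟨ det-linear (suc zero) (a zero) (u ∷ au+A) (u ∷ u ∷ rest) (u ∷ A zero ∷ rest) (λ _ → refl)
           (λ { zero _ j → refl , refl ; (suc zero) z≢z → contradiction ≡.refl z≢z ; (suc (suc i)) _ j → refl , refl }) ⟩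
    a zero * det (u ∷ u ∷ rest) + det (u ∷ A zero ∷ rest)
      ≈⟨ +-congʳ (trans (*-congˡ (det-equalRows (u ∷ u ∷ rest) (λ _ → refl))) (zeroʳ _)) ⟩
    0# + det (u ∷ A zero ∷ rest)
      ≈⟨ +-identityˡ _ ⟩
    det (u ∷ A zero ∷ rest)
      ≈⟨ det-swapRows u (A zero) rest ⟩
    - det (A zero ∷ u ∷ rest)
      ≈⟨ -‿cong (sum-cong-≋ λ j → *-congˡ {sgn j * A zero j} (minors j)) ⟩
    - det (A zero ∷ u ∷ (λ i → A (suc i)))
      ≈⟨ det-swapRows u (A zero) (λ i → A (suc i)) ⟨
    det (u ∷ A zero ∷ (λ i → A (suc i)))
      ≈⟨ det-cong (u ∷ A zero ∷ (λ i → A (suc i))) (u ∷ A)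
           (λ { zero _ → refl ; (suc zero) _ → refl ; (suc (suc i)) _ → refl }) ⟩
    det (u ∷ A) ∎
    where
    au+A : Vector (Vector Carrier (suc (suc n))) (suc n)
    au+A i j = a i * u j + A i j

    rest : Vector (Vector Carrier (suc (suc n))) n
    rest i = au+A (suc i)

    minors : ∀ j → det (minor (A zero ∷ u ∷ rest) j) ≈ det (minor (A zero ∷ u ∷ (λ i → A (suc i))) j)
    minors j = begin
      det (minor (A zero ∷ u ∷ rest) j)
        ≈⟨ det-cong (minor (A zero ∷ u ∷ rest) j) (u′ ∷ (λ i k → a (suc i) * u′ k + A′ i k))
             (λ { zero _ → refl ; (suc i) _ → refl }) ⟩
      det (u′ ∷ (λ i k → a (suc i) * u′ k + A′ i k))
        ≈⟨ det-addMultiplesOfFirstRow (λ i → a (suc i)) u′ A′ ⟩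
      det (u′ ∷ A′)
        ≈⟨ det-cong (u′ ∷ A′) (minor (A zero ∷ u ∷ (λ i → A (suc i))) j)
             (λ { zero _ → refl ; (suc i) _ → refl }) ⟩
      det (minor (A zero ∷ u ∷ (λ i → A (suc i))) j) ∎
      where
      u′ : Vector Carrier (suc n)
      u′ k = u (punchIn j k)

      A′ : Vector (Vector Carrier (suc n)) n
      A′ i k = A (suc i) (punchIn j k)

  -- Row 0 of the product is a multiple of row 0 of M, so all later rows may drop their multiples of
  -- that row. What remains in each minor is the trimmed triangular matrix `L′` times a minor of M,
  -- which is the induction hypothesis.
  det-lowerTriangular-* : ∀ {n} (L M : Matrix n) → (∀ i k → i Fin.< k → L i k ≈ 0#) →
    det (λ i j → sum λ k → L i k * M k j) ≈ product (λ i → L i i) * det M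
  det-lowerTriangular-* {zero}  L M _     = sym (*-identityˡ 1#)
  det-lowerTriangular-* {suc n} L M lower = begin
    det (λ i j → sum λ k → L i k * M k j)
      ≈⟨ det-cong (λ i j → sum λ k → L i k * M k j) N (λ { zero j → firstRow j ; (suc i) j → refl }) ⟩
    det N
      ≈⟨ det-linear zero (L zero zero) N N₁ N₀ (λ j → sym (+-identityʳ _))
           (λ { zero z≢z → contradiction ≡.refl z≢z ; (suc i) _ j → refl , refl }) ⟩
    L zero zero * det N₁ + det N₀
      ≈⟨ +-cong (*-congˡ (det-addMultiplesOfFirstRow (λ i → L (suc i) zero) (M zero) LM′))
                (sum-zero (λ j → trans (*-congʳ {det (minor N₀ j)} (zeroʳ (sgn j))) (zeroˡ _))) ⟩
    L zero zero * det (M zero ∷ LM′) + 0#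
      ≈⟨ +-identityʳ _ ⟩
    L zero zero * det (M zero ∷ LM′)
      ≈⟨ *-congˡ (sum-cong-≋ λ j → *-congˡ {sgn j * M zero j} (det-lowerTriangular-* L′ (minor M j)
           (λ i k i<k → lower (suc i) (suc k) (s<s i<k)))) ⟩
    L zero zero * sum (λ j → sgn j * M zero j * (p * det (minor M j)))
      ≈⟨ *-congˡ (sum-cong-≋ λ j → x∙yz≈y∙xz (sgn j * M zero j) p (det (minor M j))) ⟩
    L zero zero * sum (λ j → p * (sgn j * M zero j * det (minor M j)))
      ≈⟨ *-congˡ (*-distribˡ-sum p (λ j → sgn j * M zero j * det (minor M j))) ⟨
    L zero zero * (p * det M)
      ≈⟨ *-assoc _ _ _ ⟨
    product (λ i → L i i) * det M ∎
    where
    L′ : Matrix n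
    L′ i k = L (suc i) (suc k)

    p = product (λ i → L′ i i)

    LM′ : Vector (Vector Carrier (suc n)) n
    LM′ i j = sum λ k → L′ i k * M (suc k) j

    tailRows : Vector (Vector Carrier (suc n)) n
    tailRows i j = L (suc i) zero * M zero j + LM′ i j

    N N₀ N₁ : Matrix (suc n)
    N  = (λ j → L zero zero * M zero j) ∷ tailRows
    N₁ = M zero ∷ tailRows
    N₀ = (λ _ → 0#) ∷ tailRows

    firstRow : ∀ j → L zero zero * M zero j + sum (λ k → L zero (suc k) * M (suc k) j) ≈ L zero zero * M zero j
    firstRow j = trans (+-congˡ (sum-zero λ k → trans (*-congʳ (lower zero (suc k) z<s)) (zeroˡ _))) (+-identityʳ _)

  det-*-upperTriangular : ∀ {n} (M U : Matrix n) → (∀ k j → j Fin.< k → U k j ≈ 0#) →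
    det (λ i j → sum λ k → M i k * U k j) ≈ product (λ j → U j j) * det M
  det-*-upperTriangular {n} M U upper = begin
    det MU                                       ≈⟨ det-transpose _ MU ⟨
    det (flip MU)                                ≈⟨ det-cong (flip MU) (λ j i → sum λ k → U k j * M i k) (λ j i → sum-cong-≋ λ k → *-comm (M i k) (U k j)) ⟩
    det (λ j i → sum λ k → U k j * M i k)        ≈⟨ det-lowerTriangular-* (flip U) (flip M) (λ j k → upper k j) ⟩
    product (λ j → U j j) * det (flip M)         ≈⟨ *-congˡ (det-transpose _ M) ⟩
    product (λ j → U j j) * det M                ∎
    where
    MU : Matrix n
    MU i j = sum λ k → M i k * U k j

  det-firstColumn : ∀ {n} (M : Matrix (suc n)) → (∀ i → M (suc i) zero ≈ 0#) →
    det M ≈ M zero zero * det (minor M zero)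
  det-firstColumn M M₀≈0 = begin
    det M
      ≈⟨ det-transpose _ M ⟨
    1# * M zero zero * det (minor (flip M) zero) + sum (λ i → sgn (suc i) * M (suc i) zero * det (minor (flip M) (suc i)))
      ≈⟨ +-cong (*-cong (*-identityˡ _) (det-transpose _ (minor M zero)))
                (sum-zero λ i → trans (*-congʳ {det (minor (flip M) (suc i))} (trans (*-congˡ {sgn (suc i)} (M₀≈0 i)) (zeroʳ _))) (zeroˡ _)) ⟩
    M zero zero * det (minor M zero) + 0#
      ≈⟨ +-identityʳ _ ⟩
    M zero zero * det (minor M zero) ∎

-- Natural numbers inside ℚ

fromℕ-suc : ∀ k → fromℕ (suc k) ≡ 1ℚ ℚ.+ fromℕ k
fromℕ-suc = fromℕ-+ 1

fromℕ-* : ∀ m n → fromℕ (m ℕ.* n) ≡ fromℕ m ℚ.* fromℕ n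
fromℕ-* zero    n = ≡.sym (ℚ.*-zeroˡ (fromℕ n))
fromℕ-* (suc m) n = begin
  fromℕ (n ℕ.+ m ℕ.* n)                       ≡⟨ fromℕ-+ n (m ℕ.* n) ⟩
  fromℕ n ℚ.+ fromℕ (m ℕ.* n)                 ≡⟨ ≡.cong (fromℕ n ℚ.+_) (fromℕ-* m n) ⟩
  fromℕ n ℚ.+ fromℕ m ℚ.* fromℕ n             ≡⟨ solve 2 (λ m n → n :+ m :* n := (con 1ℚ :+ m) :* n) ≡.refl (fromℕ m) (fromℕ n) ⟩
  (1ℚ ℚ.+ fromℕ m) ℚ.* fromℕ n                ≡⟨ ≡.cong (ℚ._* fromℕ n) (fromℕ-suc m) ⟨
  fromℕ (suc m) ℚ.* fromℕ n                   ∎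
  where
  open ≡.≡-Reasoning
  open +-*-Solver

/-*-cancel : ∀ m n .{{_ : ℕ.NonZero n}} → (pos m ℚ./ n) ℚ.* fromℕ n ≡ fromℕ m
/-*-cancel m (suc n) = ℚ.toℚᵘ-injective (begin
  ℚ.toℚᵘ ((pos m ℚ./ suc n) ℚ.* fromℕ (suc n))
    ≈⟨ ℚ.toℚᵘ-homo-* (pos m ℚ./ suc n) (fromℕ (suc n)) ⟩
  ℚ.toℚᵘ (pos m ℚ./ suc n) ℚᵘ.* ℚ.toℚᵘ (fromℕ (suc n))
    ≈⟨ ℚᵘ.*-cong (ℚ.toℚᵘ-fromℚᵘ (pos m ℚᵘ./ suc n)) (ℚ.toℚᵘ-fromℚᵘ (pos (suc n) ℚᵘ./ 1)) ⟩
  (pos m ℚᵘ./ suc n) ℚᵘ.* (pos (suc n) ℚᵘ./ 1)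
    ≈⟨ ℚᵘ.*≡* (≡.trans (ℤ.*-identityʳ _) (≡.cong (λ k → pos m ℤ.* pos k) (≡.sym (ℕ.*-identityʳ (suc n))))) ⟩
  pos m ℚᵘ./ 1
    ≈⟨ ℚ.toℚᵘ-fromℚᵘ (pos m ℚᵘ./ 1) ⟨
  ℚ.toℚᵘ (fromℕ m) ∎)
  where open ℚᵘ.≃-Reasoning

*-cancelˡ-fromℕ : ∀ n .{{_ : ℕ.NonZero n}} {a b} → fromℕ n ℚ.* a ≡ fromℕ n ℚ.* b → a ≡ b
*-cancelˡ-fromℕ n {a} {b} na≡nb = begin
  a                                          ≡⟨ ℚ.*-identityˡ a ⟨
  1ℚ ℚ.* a                                   ≡⟨ ≡.cong (ℚ._* a) (/-*-cancel 1 n) ⟨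
  (pos 1 ℚ./ n) ℚ.* fromℕ n ℚ.* a            ≡⟨ ℚ.*-assoc (pos 1 ℚ./ n) (fromℕ n) a ⟩
  (pos 1 ℚ./ n) ℚ.* (fromℕ n ℚ.* a)          ≡⟨ ≡.cong ((pos 1 ℚ./ n) ℚ.*_) na≡nb ⟩
  (pos 1 ℚ./ n) ℚ.* (fromℕ n ℚ.* b)          ≡⟨ ℚ.*-assoc (pos 1 ℚ./ n) (fromℕ n) b ⟨
  (pos 1 ℚ./ n) ℚ.* fromℕ n ℚ.* b            ≡⟨ ≡.cong (ℚ._* b) (/-*-cancel 1 n) ⟩
  1ℚ ℚ.* b                                   ≡⟨ ℚ.*-identityˡ b ⟩
  b                                          ∎
  where open ≡.≡-Reasoning

-- The ring of formal power series over ℚ and its Euler derivation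

module PowerSeries where
  Series : Set
  Series = ℕ → ℚ

  infix 4 _≈_
  record _≈_ (F G : Series) : Set where
    constructor coefficientwise
    field
      at : ∀ k → F k ≡ G k
  open _≈_ public

  infixl 6 _+_
  infixl 7 _*_
  infix  8 -_

  const : ℚ → Series
  const a zero    = a
  const a (suc _) = 0ℚ

  t : Series
  t zero    = 0ℚ
  t (suc k) = const 1ℚ k

  _+_ : Series → Series → Series
  (F + G) k = F k ℚ.+ G k

  -_ : Series → Series
  (- F) k = ℚ.- F k

  tail : Series → Series
  tail F k = F (suc k)

  -- The Cauchy product, unrolled from F = F₀ + t · tail F. In this form the ring laws follow by
  -- induction on the coefficient index.
  _*_ : Series → Series → Series
  (F * G) zero    = F 0 ℚ.* G 0
  (F * G) (suc k) = F 0 ℚ.* G (suc k) ℚ.+ (tail F * G) k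

  -- The Euler operator t d/dt.
  θ : Series → Series
  θ F k = fromℕ k ℚ.* F k

  open ≡.≡-Reasoning

  +-congˡ : ∀ a {b c} → b ≡ c → a ℚ.+ b ≡ a ℚ.+ c
  +-congˡ a = ≡.cong (a ℚ.+_)

  *-cong : ∀ {F F′ G G′} → F ≈ F′ → G ≈ G′ → F * G ≈ F′ * G′
  *-cong F≈F′ G≈G′ = coefficientwise (go (at F≈F′) (at G≈G′))
    where
    go : ∀ {F F′ G G′} → (∀ k → F k ≡ F′ k) → (∀ k → G k ≡ G′ k) → ∀ k → (F * G) k ≡ (F′ * G′) k
    go f g zero    = ≡.cong₂ ℚ._*_ (f 0) (g 0)
    go f g (suc k) = ≡.cong₂ ℚ._+_ (≡.cong₂ ℚ._*_ (f 0) (g (suc k))) (go (f ∘ suc) g k)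

  scale-* : ∀ a F G k → ((λ l → a ℚ.* F l) * G) k ≡ a ℚ.* (F * G) k
  scale-* a F G zero    = ℚ.*-assoc a (F 0) (G 0)
  scale-* a F G (suc k) = begin
    a ℚ.* F 0 ℚ.* G (suc k) ℚ.+ ((λ l → a ℚ.* tail F l) * G) k
      ≡⟨ ≡.cong₂ ℚ._+_ (ℚ.*-assoc a (F 0) (G (suc k))) (scale-* a (tail F) G k) ⟩
    a ℚ.* (F 0 ℚ.* G (suc k)) ℚ.+ a ℚ.* (tail F * G) k
      ≡⟨ ℚ.*-distribˡ-+ a _ _ ⟨
    a ℚ.* (F * G) (suc k) ∎

  *-distribʳ-+ : ∀ H F G → (F + G) * H ≈ F * H + G * H
  *-distribʳ-+ H F G = coefficientwise (go F G)
    where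
    go : ∀ F G k → ((F + G) * H) k ≡ (F * H) k ℚ.+ (G * H) k
    go F G zero    = ℚ.*-distribʳ-+ (H 0) (F 0) (G 0)
    go F G (suc k) = ≡.trans (+-congˡ ((F 0 ℚ.+ G 0) ℚ.* H (suc k)) (go (tail F) (tail G) k))
      (solve 5 (λ f g h x y → (f :+ g) :* h :+ (x :+ y) := (f :* h :+ x) :+ (g :* h :+ y))
        ≡.refl (F 0) (G 0) (H (suc k)) ((tail F * H) k) ((tail G * H) k))
      where open +-*-Solver

  *-assoc : ∀ F G H → (F * G) * H ≈ F * (G * H)
  *-assoc F G H = coefficientwise (go F)
    where
    go : ∀ F k → ((F * G) * H) k ≡ (F * (G * H)) k
    go F zero    = ℚ.*-assoc (F 0) (G 0) (H 0)
    go F (suc k) = begin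
      F 0 ℚ.* G 0 ℚ.* H (suc k) ℚ.+ ((λ l → F 0 ℚ.* tail G l ℚ.+ (tail F * G) l) * H) k
        ≡⟨ +-congˡ (F 0 ℚ.* G 0 ℚ.* H (suc k)) (at (*-distribʳ-+ H (λ l → F 0 ℚ.* tail G l) (tail F * G)) k) ⟩
      F 0 ℚ.* G 0 ℚ.* H (suc k) ℚ.+ (((λ l → F 0 ℚ.* tail G l) * H) k ℚ.+ ((tail F * G) * H) k)
        ≡⟨ +-congˡ (F 0 ℚ.* G 0 ℚ.* H (suc k)) (≡.cong₂ ℚ._+_ (scale-* (F 0) (tail G) H k) (go (tail F) k)) ⟩
      F 0 ℚ.* G 0 ℚ.* H (suc k) ℚ.+ (F 0 ℚ.* (tail G * H) k ℚ.+ (tail F * (G * H)) k)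
        ≡⟨ solve 5 (λ f g h x y → f :* g :* h :+ (f :* x :+ y) := f :* (g :* h :+ x) :+ y)
             ≡.refl (F 0) (G 0) (H (suc k)) ((tail G * H) k) ((tail F * (G * H)) k) ⟩
      (F * (G * H)) (suc k) ∎
      where open +-*-Solver

  -- The mirror image of the defining recursion, peeling the right factor instead of the left one.
  -- Commutativity is an induction that plays the two against each other.
  *-unfoldʳ : ∀ F G k → (F * G) (suc k) ≡ G 0 ℚ.* F (suc k) ℚ.+ (F * tail G) k
  *-unfoldʳ F G zero = solve 4 (λ f₀ f₁ g₀ g₁ → f₀ :* g₁ :+ f₁ :* g₀ := g₀ :* f₁ :+ f₀ :* g₁)
    ≡.refl (F 0) (F 1) (G 0) (G 1)
    where open +-*-Solver
  *-unfoldʳ F G (suc k) = ≡.trans (+-congˡ (F 0 ℚ.* G (suc (suc k))) (*-unfoldʳ (tail F) G k))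
    (solve 3 (λ x y z → x :+ (y :+ z) := y :+ (x :+ z)) ≡.refl (F 0 ℚ.* G (suc (suc k))) (G 0 ℚ.* F (suc (suc k))) ((tail F * tail G) k))
    where open +-*-Solver

  *-comm : ∀ F G → F * G ≈ G * F
  *-comm F G = coefficientwise (go F)
    where
    go : ∀ F k → (F * G) k ≡ (G * F) k
    go F zero    = ℚ.*-comm (F 0) (G 0)
    go F (suc k) = ≡.trans (+-congˡ (F 0 ℚ.* G (suc k)) (go (tail F) k)) (≡.sym (*-unfoldʳ G F k))

  zero-* : ∀ F k → ((λ _ → 0ℚ) * F) k ≡ 0ℚ
  zero-* F zero    = ℚ.*-zeroˡ (F 0)
  zero-* F (suc k) = ≡.trans (≡.cong₂ ℚ._+_ (ℚ.*-zeroˡ (F (suc k))) (zero-* F k)) (ℚ.+-identityˡ 0ℚ)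

  const-* : ∀ a F k → (const a * F) k ≡ a ℚ.* F k
  const-* a F zero    = ≡.refl
  const-* a F (suc k) = ≡.trans (+-congˡ (a ℚ.* F (suc k)) (zero-* F k)) (ℚ.+-identityʳ _)

  t-*-zero : ∀ F → (t * F) 0 ≡ 0ℚ
  t-*-zero F = ℚ.*-zeroˡ (F 0)

  t-*-suc : ∀ F k → (t * F) (suc k) ≡ F k
  t-*-suc F k = ≡.trans (≡.cong₂ ℚ._+_ (ℚ.*-zeroˡ (F (suc k))) (≡.trans (const-* 1ℚ F k) (ℚ.*-identityˡ (F k))))
    (ℚ.+-identityˡ (F k))

  *-identityˡ : ∀ F → const 1ℚ * F ≈ F
  *-identityˡ F = coefficientwise λ k → ≡.trans (const-* 1ℚ F k) (ℚ.*-identityˡ (F k))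

  +-*-commutativeRing : CommutativeRing 0ℓ 0ℓ
  +-*-commutativeRing = record
    { Carrier = Series
    ; _≈_ = _≈_
    ; _+_ = _+_
    ; _*_ = _*_
    ; -_ = -_
    ; 0# = λ _ → 0ℚ
    ; 1# = const 1ℚ
    ; isCommutativeRing = record
      { isRing = record
        { +-isAbelianGroup = record
          { isGroup = record
            { isMonoid = record
              { isSemigroup = record
                { isMagma = record
                  { isEquivalence = record
                    { refl = coefficientwise λ _ → ≡.refl
                    ; sym = λ p → coefficientwise (λ k → ≡.sym (at p k))
                    ; trans = λ p q → coefficientwise (λ k → ≡.trans (at p k) (at q k))
                    }
                  ; ∙-cong = λ p q → coefficientwise (λ k → ≡.cong₂ ℚ._+_ (at p k) (at q k))
                  }
                ; assoc = λ F G H → coefficientwise (λ k → ℚ.+-assoc (F k) (G k) (H k))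
                }
              ; identity = (λ F → coefficientwise (λ k → ℚ.+-identityˡ (F k)))
                         , (λ F → coefficientwise (λ k → ℚ.+-identityʳ (F k)))
              }
            ; inverse = (λ F → coefficientwise (λ k → ℚ.+-inverseˡ (F k)))
                      , (λ F → coefficientwise (λ k → ℚ.+-inverseʳ (F k)))
            ; ⁻¹-cong = λ p → coefficientwise (λ k → ≡.cong ℚ.-_ (at p k))
            }
          ; comm = λ F G → coefficientwise (λ k → ℚ.+-comm (F k) (G k))
          }
        ; *-cong = *-cong
        ; *-assoc = *-assoc
        ; *-identity = *-identityˡ , λ F → trans (*-comm F (const 1ℚ)) (*-identityˡ F)
        ; distrib = (λ F G H → trans (*-comm F (G + H)) (trans (*-distribʳ-+ F G H)
                      (coefficientwise λ k → ≡.cong₂ ℚ._+_ (at (*-comm G F) k) (at (*-comm H F) k))))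
                  , *-distribʳ-+
        }
      ; *-comm = *-comm
      }
    }
    where
    trans : ∀ {F G H} → F ≈ G → G ≈ H → F ≈ H
    trans p q = coefficientwise (λ k → ≡.trans (at p k) (at q k))

  const-homomorphism : ℚ.+-*-rawRing -Raw-AlmostCommutative⟶ fromCommutativeRing +-*-commutativeRing
  const-homomorphism = record
    { ⟦_⟧    = const
    ; +-homo = λ _ _ → coefficientwise λ { zero → ≡.refl ; (suc _) → ≡.refl }
    ; *-homo = λ a b → coefficientwise λ { zero → ≡.refl
                                         ; (suc k) → ≡.sym (≡.trans (const-* a (const b) (suc k)) (ℚ.*-zeroʳ a)) }
    ; -‿homo = λ _ → coefficientwise λ { zero → ≡.refl ; (suc _) → ≡.refl }
    ; 0-homo = coefficientwise λ { zero → ≡.refl ; (suc _) → ≡.refl }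
    ; 1-homo = coefficientwise λ _ → ≡.refl
    }

  module Solver = RingSolver ℚ.+-*-rawRing (fromCommutativeRing +-*-commutativeRing) const-homomorphism
    (λ a b → Maybe.map (λ a≡b → coefficientwise λ k → ≡.cong (λ c → const c k) a≡b) (dec⇒maybe (a ℚ.≟ b)))

  θ-cong : ∀ {F G} → F ≈ G → θ F ≈ θ G
  θ-cong F≈G = coefficientwise λ k → ≡.cong (fromℕ k ℚ.*_) (at F≈G k)

  θ-+ : ∀ F G → θ (F + G) ≈ θ F + θ G
  θ-+ F G = coefficientwise λ k → ℚ.*-distribˡ-+ (fromℕ k) (F k) (G k)

  -- Induction on the index. Passing to the tail lowers the index by one, so tail (θ F) is θ (tail
  -- F) plus a correction tail F.
  θ-* : ∀ F G → θ (F * G) ≈ θ F * G + F * θ G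
  θ-* F G = coefficientwise (go F)
    where
    tail-θ : ∀ F k → tail (θ F) k ≡ (θ (tail F) + tail F) k
    tail-θ F k = ≡.trans (≡.cong (ℚ._* F (suc k)) (fromℕ-suc k))
      (solve 2 (λ n f → (con 1ℚ :+ n) :* f := n :* f :+ f) ≡.refl (fromℕ k) (F (suc k)))
      where open +-*-Solver

    go : ∀ F k → θ (F * G) k ≡ (θ F * G) k ℚ.+ (F * θ G) k
    go F zero = solve 2 (λ f g → con 0ℚ :* (f :* g) := con 0ℚ :* f :* g :+ f :* (con 0ℚ :* g)) ≡.refl (F 0) (G 0)
      where open +-*-Solver
    go F (suc k) = begin
      fromℕ (suc k) ℚ.* (F 0 ℚ.* G (suc k) ℚ.+ (tail F * G) k)
        ≡⟨ split ⟩
      F 0 ℚ.* (fromℕ (suc k) ℚ.* G (suc k)) ℚ.+ (fromℕ k ℚ.* (tail F * G) k ℚ.+ (tail F * G) k)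
        ≡⟨ ≡.cong (λ z → F 0 ℚ.* (fromℕ (suc k) ℚ.* G (suc k)) ℚ.+ (z ℚ.+ (tail F * G) k)) (go (tail F) k) ⟩
      F 0 ℚ.* (fromℕ (suc k) ℚ.* G (suc k)) ℚ.+ ((θ (tail F) * G) k ℚ.+ (tail F * θ G) k ℚ.+ (tail F * G) k)
        ≡⟨ solve 6 (λ f g x y z w → x :+ (y :+ z :+ w) := (con 0ℚ :* f :* g :+ (y :+ w)) :+ (x :+ z))
             ≡.refl (F 0) (G (suc k)) (F 0 ℚ.* (fromℕ (suc k) ℚ.* G (suc k)))
             ((θ (tail F) * G) k) ((tail F * θ G) k) ((tail F * G) k) ⟩
      (0ℚ ℚ.* F 0 ℚ.* G (suc k) ℚ.+ ((θ (tail F) * G) k ℚ.+ (tail F * G) k)) ℚ.+ (F * θ G) (suc k)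
        ≡⟨ ≡.cong (λ z → (0ℚ ℚ.* F 0 ℚ.* G (suc k) ℚ.+ z) ℚ.+ (F * θ G) (suc k))
             (≡.trans (≡.sym (at (*-distribʳ-+ G (θ (tail F)) (tail F)) k))
                      (at (*-cong {G = G} (coefficientwise λ l → ≡.sym (tail-θ F l)) (coefficientwise λ _ → ≡.refl)) k)) ⟩
      (θ F * G) (suc k) ℚ.+ (F * θ G) (suc k) ∎
      where
      open +-*-Solver
      split : fromℕ (suc k) ℚ.* (F 0 ℚ.* G (suc k) ℚ.+ (tail F * G) k) ≡
              F 0 ℚ.* (fromℕ (suc k) ℚ.* G (suc k)) ℚ.+ (fromℕ k ℚ.* (tail F * G) k ℚ.+ (tail F * G) k)
      split = ≡.trans
        (solve 4 (λ n f g x → n :* (f :* g :+ x) := f :* (n :* g) :+ n :* x)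
          ≡.refl (fromℕ (suc k)) (F 0) (G (suc k)) ((tail F * G) k))
        (≡.cong (F 0 ℚ.* (fromℕ (suc k) ℚ.* G (suc k)) ℚ.+_) (≡.trans (≡.cong (ℚ._* (tail F * G) k) (fromℕ-suc k))
          (solve 2 (λ n x → (con 1ℚ :+ n) :* x := n :* x :+ x) ≡.refl (fromℕ k) ((tail F * G) k))))

module ℚDet = DeterminantProperties ℚ.+-*-commutativeRing
open ℚDet using () renaming (det to detℚ)
open RawSemiringDefs (RawRing.rawSemiring ℚ.+-*-rawRing) using () renaming (product to ∏; _^_ to _^ℚ_)
open SemiringSum (CommutativeRing.semiring ℚ.+-*-commutativeRing) using (sum; sum-cong-≗; ∑-distrib-+)
open CommutativeMonoidSum ℚ.*-1-commutativeMonoid using () renaming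
  (sum-cong-≗ to product-cong; ∑-distrib-+ to product-distrib-*; sum-replicate-zero to product-replicate-one)

-- Binomial series and the differential equation

module DeterminantRecurrence where
  open PowerSeries hiding (*-cong; *-comm; *-assoc; *-identityˡ; +-congˡ)
  open CommutativeRing +-*-commutativeRing
    using (refl; sym; trans; setoid; +-cong; +-congˡ; +-congʳ; *-cong; *-congˡ; *-congʳ; *-identityˡ; -‿cong)
  open _-Raw-AlmostCommutative⟶_ const-homomorphism using (+-homo; *-homo)
  open ℚDet

  -- (1 - t)⁻ᵃ
  G : ℚ → Series
  G a zero    = 1ℚ
  G a (suc k) = (pos 1 ℚ./ suc k) ℚ.* ((a ℚ.+ fromℕ k) ℚ.* G a k)

  *-G-suc : ∀ a k → fromℕ (suc k) ℚ.* G a (suc k) ≡ (a ℚ.+ fromℕ k) ℚ.* G a k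
  *-G-suc a k = begin
    fromℕ (suc k) ℚ.* ((pos 1 ℚ./ suc k) ℚ.* g)   ≡⟨ ℚ.*-assoc (fromℕ (suc k)) (pos 1 ℚ./ suc k) g ⟨
    fromℕ (suc k) ℚ.* (pos 1 ℚ./ suc k) ℚ.* g     ≡⟨ ≡.cong (ℚ._* g) (≡.trans (ℚ.*-comm (fromℕ (suc k)) _) (/-*-cancel 1 (suc k))) ⟩
    1ℚ ℚ.* g                                      ≡⟨ ℚ.*-identityˡ g ⟩
    g                                             ∎
    where
    open ≡.≡-Reasoning
    g = (a ℚ.+ fromℕ k) ℚ.* G a k

  -- The recurrence is (1 - t) F′ = a F, read coefficientwise. It serves to recognise both `h` and
  -- the binomial coefficients as values of `G`.
  G-unique : ∀ a (F : Series) → F 0 ≡ 1ℚ →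
    (∀ k → fromℕ (suc k) ℚ.* F (suc k) ≡ (a ℚ.+ fromℕ k) ℚ.* F k) → ∀ k → F k ≡ G a k
  G-unique a F F₀ F-suc zero    = F₀
  G-unique a F F₀ F-suc (suc k) = *-cancelˡ-fromℕ (suc k) (≡.trans (F-suc k)
    (≡.trans (≡.cong ((a ℚ.+ fromℕ k) ℚ.*_) (G-unique a F F₀ F-suc k)) (≡.sym (*-G-suc a k))))

  -- Both sides are (a)ₖ₊₁ / k!.
  *-G-shift : ∀ a k → a ℚ.* G (a ℚ.+ 1ℚ) k ≡ (a ℚ.+ fromℕ k) ℚ.* G a k
  *-G-shift a zero    = solve 1 (λ a → a :* con 1ℚ := (a :+ con 0ℚ) :* con 1ℚ) ≡.refl a
    where open +-*-Solver
  *-G-shift a (suc k) = *-cancelˡ-fromℕ (suc k) (begin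
    fromℕ (suc k) ℚ.* (a ℚ.* G (a ℚ.+ 1ℚ) (suc k))
      ≡⟨ solve 3 (λ n a g → n :* (a :* g) := a :* (n :* g)) ≡.refl (fromℕ (suc k)) a (G (a ℚ.+ 1ℚ) (suc k)) ⟩
    a ℚ.* (fromℕ (suc k) ℚ.* G (a ℚ.+ 1ℚ) (suc k))
      ≡⟨ ≡.cong (a ℚ.*_) (*-G-suc (a ℚ.+ 1ℚ) k) ⟩
    a ℚ.* ((a ℚ.+ 1ℚ ℚ.+ fromℕ k) ℚ.* G (a ℚ.+ 1ℚ) k)
      ≡⟨ solve 3 (λ n a g → a :* ((a :+ con 1ℚ :+ n) :* g) := (a :+ (con 1ℚ :+ n)) :* (a :* g)) ≡.refl (fromℕ k) a (G (a ℚ.+ 1ℚ) k) ⟩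
    (a ℚ.+ (1ℚ ℚ.+ fromℕ k)) ℚ.* (a ℚ.* G (a ℚ.+ 1ℚ) k)
      ≡⟨ ≡.cong₂ (λ n g → (a ℚ.+ n) ℚ.* g) (≡.sym (fromℕ-suc k)) (≡.trans (*-G-shift a k) (≡.sym (*-G-suc a k))) ⟩
    (a ℚ.+ fromℕ (suc k)) ℚ.* (fromℕ (suc k) ℚ.* G a (suc k))
      ≡⟨ solve 3 (λ n a g → (a :+ n) :* (n :* g) := n :* ((a :+ n) :* g)) ≡.refl (fromℕ (suc k)) a (G a (suc k)) ⟩
    fromℕ (suc k) ℚ.* ((a ℚ.+ fromℕ (suc k)) ℚ.* G a (suc k)) ∎)
    where
    open ≡.≡-Reasoning
    open +-*-Solver

  G-pascal : ∀ a k → G (a ℚ.+ 1ℚ) (suc k) ≡ G a (suc k) ℚ.+ G (a ℚ.+ 1ℚ) k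
  G-pascal a k = *-cancelˡ-fromℕ (suc k) (begin
    fromℕ (suc k) ℚ.* G (a ℚ.+ 1ℚ) (suc k)
      ≡⟨ *-G-suc (a ℚ.+ 1ℚ) k ⟩
    (a ℚ.+ 1ℚ ℚ.+ fromℕ k) ℚ.* G (a ℚ.+ 1ℚ) k
      ≡⟨ solve 3 (λ n a g → (a :+ con 1ℚ :+ n) :* g := a :* g :+ (con 1ℚ :+ n) :* g) ≡.refl (fromℕ k) a (G (a ℚ.+ 1ℚ) k) ⟩
    a ℚ.* G (a ℚ.+ 1ℚ) k ℚ.+ (1ℚ ℚ.+ fromℕ k) ℚ.* G (a ℚ.+ 1ℚ) k
      ≡⟨ ≡.cong₂ (λ g n → g ℚ.+ n ℚ.* G (a ℚ.+ 1ℚ) k) (≡.trans (*-G-shift a k) (≡.sym (*-G-suc a k))) (≡.sym (fromℕ-suc k)) ⟩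
    fromℕ (suc k) ℚ.* G a (suc k) ℚ.+ fromℕ (suc k) ℚ.* G (a ℚ.+ 1ℚ) k
      ≡⟨ ℚ.*-distribˡ-+ (fromℕ (suc k)) (G a (suc k)) (G (a ℚ.+ 1ℚ) k) ⟨
    fromℕ (suc k) ℚ.* (G a (suc k) ℚ.+ G (a ℚ.+ 1ℚ) k) ∎)
    where
    open ≡.≡-Reasoning
    open +-*-Solver

  -- h = 1/(1 - t) and b = t (3 + t)/(1 - t).
  1-t h q b : Series
  1-t = const 1ℚ + - t
  h _ = 1ℚ
  q = const (fromℕ 3) + const (fromℕ 2) * t + - (t * t)
  b = t * (const (fromℕ 3) + t) * h

  1-t-* : ∀ F k → (1-t * F) (suc k) ≡ F (suc k) ℚ.- F k
  1-t-* F k = ≡.trans (at expand (suc k)) (≡.cong (λ z → F (suc k) ℚ.- z) (t-*-suc F k))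
    where
    open Solver
    expand : 1-t * F ≈ F + - (t * F)
    expand = solve 2 (λ t F → (con 1ℚ :+ (:- t)) :* F := F :+ (:- (t :* F))) refl t F

  1-t-*-h : 1-t * h ≈ const 1ℚ
  1-t-*-h = coefficientwise λ { zero → ≡.refl ; (suc k) → 1-t-* h k }

  -- Proves identities modulo the relation (1 - t) h = 1.
  mod-1-t-*-h : ∀ {L R} S → L + S ≈ R + S * (1-t * h) → L ≈ R
  mod-1-t-*-h {L} {R} S L+S≈R+Se = begin
    L                           ≈⟨ solve 2 (λ L S → L := L :+ S :+ (:- S)) refl L S ⟩
    L + S + - S                 ≈⟨ +-congʳ (trans L+S≈R+Se (+-congˡ {R} (*-congˡ {S} 1-t-*-h))) ⟩
    R + S * const 1ℚ + - S      ≈⟨ solve 2 (λ R S → R :+ S :* con 1ℚ :+ (:- S) := R) refl R S ⟩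
    R                           ∎
    where
    open SetoidReasoning setoid
    open Solver

  1-t-*-G : ∀ a → 1-t * G (a ℚ.+ 1ℚ) ≈ G a
  1-t-*-G a = coefficientwise λ
    { zero    → ≡.refl
    ; (suc k) → ≡.trans (1-t-* (G (a ℚ.+ 1ℚ)) k) (≡.trans (≡.cong (ℚ._- G (a ℚ.+ 1ℚ) k) (G-pascal a k))
        (solve 2 (λ x y → x :+ y :- y := x) ≡.refl (G a (suc k)) (G (a ℚ.+ 1ℚ) k)))
    }
    where open +-*-Solver

  G-+1 : ∀ a → G (a ℚ.+ 1ℚ) ≈ h * G a
  G-+1 a = trans
    (mod-1-t-*-h (- g) (solve 3 (λ t h g → g :+ (:- g) := h :* ((con 1ℚ :+ (:- t)) :* g) :+ (:- g) :* ((con 1ℚ :+ (:- t)) :* h)) refl t h g))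
    (*-congˡ (1-t-*-G a))
    where
    open Solver
    g = G (a ℚ.+ 1ℚ)

  -- The recurrence `*-G-suc` amounts to (1 - t) θ G = a t G, and multiplication by h undoes the
  -- factor 1 - t.
  θ-G : ∀ a → θ (G a) ≈ const a * (t * (h * G a))
  θ-G a = mod-1-t-*-h (- θ (G a)) (begin
    θ (G a) + - θ (G a)
      ≈⟨ solve 4 (λ x t g h → x :+ (:- x) := (t :* g) :* h :+ (:- (t :* g)) :* h) refl (θ (G a)) t (const a * G a) h ⟩
    t * (const a * G a) * h + - (t * (const a * G a)) * h
      ≈⟨ +-congˡ {t * (const a * G a) * h} (*-congʳ {h} (-‿cong (sym equation))) ⟩
    t * (const a * G a) * h + - (1-t * θ (G a)) * h
      ≈⟨ solve 5 (λ x t g h a → t :* (a :* g) :* h :+ (:- ((con 1ℚ :+ (:- t)) :* x)) :* h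
                  := a :* (t :* (h :* g)) :+ (:- x) :* ((con 1ℚ :+ (:- t)) :* h)) refl (θ (G a)) t (G a) h (const a) ⟩
    const a * (t * (h * G a)) + - θ (G a) * (1-t * h) ∎)
    where
    open SetoidReasoning setoid
    open Solver
    equation : 1-t * θ (G a) ≈ t * (const a * G a)
    equation = coefficientwise λ
      { zero    → ≡.sym (t-*-zero (const a * G a))
      ; (suc k) → ≡.trans (1-t-* (θ (G a)) k) (≡.trans
          (≡.trans (≡.cong (ℚ._- fromℕ k ℚ.* G a k) (*-G-suc a k))
            (+-*-Solver.solve 3 (λ a n g → (a +-*-Solver.:+ n) +-*-Solver.:* g +-*-Solver.:- n +-*-Solver.:* g +-*-Solver.:= a +-*-Solver.:* g)
              ≡.refl a (fromℕ k) (G a k)))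
          (≡.sym (≡.trans (t-*-suc (const a * G a) k) (const-* a (G a) k))))
      }

  θt : θ t ≈ t
  θt = coefficientwise λ { zero → ≡.refl ; (suc zero) → ≡.refl ; (suc (suc k)) → ℚ.*-zeroʳ (fromℕ (suc (suc k))) }

  θ-const : ∀ a → θ (const a) ≈ const 0ℚ
  θ-const a = coefficientwise λ { zero → ℚ.*-zeroˡ a ; (suc k) → ℚ.*-zeroʳ (fromℕ (suc k)) }

  G-1 : ∀ k → h k ≡ G 1ℚ k
  G-1 = G-unique 1ℚ h ≡.refl (λ k → ≡.cong (ℚ._* 1ℚ) (fromℕ-suc k))

  θh : θ h ≈ t * (h * h)
  θh = begin
    θ h                              ≈⟨ θ-cong h≈G ⟩
    θ (G 1ℚ)                         ≈⟨ θ-G 1ℚ ⟩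
    const 1ℚ * (t * (h * G 1ℚ))      ≈⟨ *-identityˡ _ ⟩
    t * (h * G 1ℚ)                   ≈⟨ *-congˡ {t} (*-congˡ {h} h≈G) ⟨
    t * (h * h)                      ∎
    where
    open SetoidReasoning setoid
    h≈G : h ≈ G 1ℚ
    h≈G = coefficientwise G-1

  -- This is t b′ as the product rule delivers it, with both h and h²; modulo (1 - t) h = 1 it
  -- equals t q h².
  θb : Series
  θb = (const (fromℕ 3) * t + const (fromℕ 2) * (t * t)) * h + (const (fromℕ 3) * (t * t) + t * t * t) * (h * h)

  θ-b : θ b ≈ θb
  θ-b = begin
    θ (t * (c3 + t) * h)
      ≈⟨ θ-* (t * (c3 + t)) h ⟩
    θ (t * (c3 + t)) * h + t * (c3 + t) * θ h
      ≈⟨ +-cong (*-congʳ (trans (θ-* t (c3 + t)) (+-cong (*-congʳ θt) (*-congˡ (trans (θ-+ c3 t) (+-cong (θ-const (fromℕ 3)) θt))))))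
                (*-congˡ θh) ⟩
    (t * (c3 + t) + t * (const 0ℚ + t)) * h + t * (c3 + t) * (t * (h * h))
      ≈⟨ solve 2 (λ t h → (t :* (con (fromℕ 3) :+ t) :+ t :* (con 0ℚ :+ t)) :* h :+ t :* (con (fromℕ 3) :+ t) :* (t :* (h :* h))
           := (con (fromℕ 3) :* t :+ con (fromℕ 2) :* (t :* t)) :* h :+ (con (fromℕ 3) :* (t :* t) :+ t :* t :* t) :* (h :* h)) refl t h ⟩
    θb ∎
    where
    open SetoidReasoning setoid
    open Solver
    c3 = const (fromℕ 3)

  y : ℚ → ℕ → Series
  y a zero    = G a
  y a (suc i) = b * y a i

  y-+1 : ∀ a i → y (a ℚ.+ 1ℚ) i ≈ h * y a i
  y-+1 a zero    = G-+1 a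
  y-+1 a (suc i) = trans (*-congˡ (y-+1 a i)) (solve 3 (λ b h y → b :* (h :* y) := h :* (b :* y)) refl b h (y a i))
    where open Solver

  θ-y-suc : ∀ a i → θ (y a (suc i)) ≈ const a * (t * (h * y a (suc i))) + const (fromℕ (suc i)) * (θb * y a i)
  θ-y-suc a i = trans (θ-* b (y a i)) (trans (+-cong (*-congʳ θ-b) (*-congˡ (θ-y i))) (rest i))
    where
    -- At i = 0 the default value of `ℕ.pred` is multiplied by 0; the same convention is used for
    -- `R` in `ode`.
    θ-y : ∀ i → θ (y a i) ≈ const a * (t * (h * y a i)) + const (fromℕ i) * (θb * y a (ℕ.pred i))
    θ-y zero    = trans (θ-G a) (coefficientwise λ k → ≡.sym (≡.trans
      (≡.cong ((const a * (t * (h * G a))) k ℚ.+_) (≡.trans (const-* 0ℚ (θb * G a) k) (ℚ.*-zeroˡ ((θb * G a) k)))) (ℚ.+-identityʳ _)))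
    θ-y (suc i) = θ-y-suc a i

    rest : ∀ i → θb * y a i + b * (const a * (t * (h * y a i)) + const (fromℕ i) * (θb * y a (ℕ.pred i)))
           ≈ const a * (t * (h * (b * y a i))) + const (fromℕ (suc i)) * (θb * y a i)
    rest zero = solve 6 (λ d b t h g a → d :* g :+ b :* (a :* (t :* (h :* g)) :+ con 0ℚ :* (d :* g))
        := a :* (t :* (h :* (b :* g))) :+ con 1ℚ :* (d :* g)) refl θb b t h (G a) (const a)
      where open Solver
    rest (suc i) = trans
      (solve 7 (λ d b t h y a n → d :* (b :* y) :+ b :* (a :* (t :* (h :* (b :* y))) :+ n :* (d :* y))
        := a :* (t :* (h :* (b :* (b :* y)))) :+ (con 1ℚ :+ n) :* (d :* (b :* y))) refl θb b t h (y a i) (const a) (const (fromℕ (suc i))))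
      (+-congˡ {const a * (t * (h * (b * (b * y a i))))} (*-congʳ {θb * (b * y a i)} (trans (sym (+-homo 1ℚ (fromℕ (suc i)))) (coefficientwise λ k → ≡.cong (λ c → const c k) (≡.sym (fromℕ-suc (suc i)))))))
      where open Solver

  R : ℚ → ℕ → Series
  R a i = q * h * y a i

  q′ : ∀ {n} → Solver.Polynomial n → Solver.Polynomial n
  q′ t = con (fromℕ 3) :+ con (fromℕ 2) :* t :+ (:- (t :* t))
    where open Solver

  -- The differential equation for yᵢ, multiplied by t.
  ode : ∀ a i → const (fromℕ 3) * θ (y a i) + t * (t * (θ (y a i) + (const a * y a i + const a * y a i)))
    ≈ t * ((const (fromℕ i) * R a i + const a * R a i) + const (fromℕ 3) * (const (fromℕ i) * R a (ℕ.pred i)))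
  ode a zero = trans (+-cong (*-congˡ {const (fromℕ 3)} (θ-G a)) (*-congˡ {t} (*-congˡ {t} (+-congʳ {const a * G a + const a * G a} (θ-G a)))))
    -- Here the left side minus the right side is 2 a t² G (1 - (1 - t) h).
    (mod-1-t-*-h (- (const (fromℕ 2) * const a * G a * (t * t)))
      (solve 4 (λ t h g a →
         con (fromℕ 3) :* (a :* (t :* (h :* g))) :+ t :* (t :* (a :* (t :* (h :* g)) :+ (a :* g :+ a :* g)))
           :+ (:- (con (fromℕ 2) :* a :* g :* (t :* t)))
         := t :* ((con 0ℚ :* (q′ t :* h :* g) :+ a :* (q′ t :* h :* g)) :+ con (fromℕ 3) :* (con 0ℚ :* (q′ t :* h :* g)))
           :+ (:- (con (fromℕ 2) :* a :* g :* (t :* t))) :* ((con 1ℚ :+ (:- t)) :* h))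
        refl t h (G a) (const a)))
    where
    open Solver
  ode a (suc i) = trans (+-cong (*-congˡ {const (fromℕ 3)} (θ-y-suc a i))
      (*-congˡ {t} (*-congˡ {t} (+-congʳ {const a * y a (suc i) + const a * y a (suc i)} (θ-y-suc a i)))))
    -- The multiple of a is as in the case i = 0. In the difference of the two sides, the multiple
    -- of i + 1 is A h + B h² times yᵢ with A = (3 + t²)(3t + 2t²) - 3 t q and B = - (1 - t) A,
    -- hence A h (1 - (1 - t) h) times yᵢ.
    (mod-1-t-*-h (- (const (fromℕ 2) * const a * (t * t) * y a (suc i)
        + const (fromℕ (suc i)) * y a i * ((const (fromℕ 3) + t * t) * (const (fromℕ 3) * t + const (fromℕ 2) * (t * t)) * h
                                           + - (const (fromℕ 3) * t * q * h))))
      (solve 5 (λ t h Y a n →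
         con (fromℕ 3) :* θy t h Y a n :+ t :* (t :* (θy t h Y a n :+ (a :* (b′ t h :* Y) :+ a :* (b′ t h :* Y))))
           :+ S t h Y a n
         := t :* ((n :* (q′ t :* h :* (b′ t h :* Y)) :+ a :* (q′ t :* h :* (b′ t h :* Y)))
                   :+ con (fromℕ 3) :* (n :* (q′ t :* h :* Y)))
           :+ S t h Y a n :* ((con 1ℚ :+ (:- t)) :* h))
        refl t h (y a i) (const a) (const (fromℕ (suc i)))))
    where
    open Solver
    b′ : ∀ {n} (t h : Polynomial n) → Polynomial n
    b′ t h = t :* (con (fromℕ 3) :+ t) :* h
    θy S : ∀ {n} (t h Y a m : Polynomial n) → Polynomial n
    θy t h Y a n = a :* (t :* (h :* (b′ t h :* Y))) :+ n :* (((con (fromℕ 3) :* t :+ con (fromℕ 2) :* (t :* t)) :* h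
      :+ (con (fromℕ 3) :* (t :* t) :+ t :* t :* t) :* (h :* h)) :* Y)
    S t h Y a n = :- (con (fromℕ 2) :* a :* (t :* t) :* (b′ t h :* Y)
      :+ n :* Y :* ((con (fromℕ 3) :+ t :* t) :* (con (fromℕ 3) :* t :+ con (fromℕ 2) :* (t :* t)) :* h
                    :+ (:- (con (fromℕ 3) :* t :* q′ t :* h))))

  infix 9 [1-t²][9-t²]_

  -- Written as three unit steps so that `y-+1` applies three times without rewriting a.
  _+3 : ℚ → ℚ
  a +3 = a ℚ.+ 1ℚ ℚ.+ 1ℚ ℚ.+ 1ℚ

  y-+3 : ∀ a i → y (a +3) i ≈ h * (h * (h * y a i))
  y-+3 a i = trans (y-+1 (a ℚ.+ 1ℚ ℚ.+ 1ℚ) i) (*-congˡ {h} (trans (y-+1 (a ℚ.+ 1ℚ) i) (*-congˡ {h} (y-+1 a i))))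

  -- Multiplied out as 9 - 10 t² + t⁴ with the factors t nested, the form from which `odd-t-*-t`
  -- reads off odd coefficients.
  [1-t²][9-t²]_ : Series → Series
  [1-t²][9-t²] F = const (fromℕ 9) * F + const (ℚ.- fromℕ 10) * (t * (t * F)) + t * (t * (t * (t * F)))

  -- Since q = (3 - t)(1 + t), the product q h b is t (9 - t²)(1 + t) h². Trading 1 + t for (1 - t²)
  -- h makes the polynomial factor t times an even one, and the resulting h³ raises a by 3.
  R-suc : ∀ a i → R a (suc i) ≈ t * [1-t²][9-t²] y (a +3) i
  R-suc a i = trans
    (mod-1-t-*-h (- R a (suc i))
      (solve 3 (λ t h Y →
         q′ t :* h :* (t :* (con (fromℕ 3) :+ t) :* h :* Y) :+ (:- (q′ t :* h :* (t :* (con (fromℕ 3) :+ t) :* h :* Y)))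
         := t :* (con (fromℕ 9) :* ŷ h Y :+ con (ℚ.- fromℕ 10) :* (t :* (t :* ŷ h Y)) :+ t :* (t :* (t :* (t :* ŷ h Y))))
            :+ (:- (q′ t :* h :* (t :* (con (fromℕ 3) :+ t) :* h :* Y))) :* ((con 1ℚ :+ (:- t)) :* h))
        refl t h (y a i)))
    (*-congˡ {t} (+-cong (+-cong (*-congˡ {const (fromℕ 9)} ŷ≈) (*-congˡ {const (ℚ.- fromℕ 10)} (*-congˡ {t} (*-congˡ {t} ŷ≈))))
      (*-congˡ {t} (*-congˡ {t} (*-congˡ {t} (*-congˡ {t} ŷ≈))))))
    where
    open Solver
    ŷ : ∀ {n} (h Y : Polynomial n) → Polynomial n
    ŷ h Y = h :* (h :* (h :* Y))
    ŷ≈ = sym (y-+3 a i)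

  -- Odd and even coefficients

  -- Each step yields two visible successors, so two factors t can be peeled off by computation.
  double : ℕ → ℕ
  double zero    = zero
  double (suc j) = suc (suc (double j))

  odd even shift : Series → Series
  odd  F j = F (suc (double j))
  even F j = F (double j)
  shift F zero    = 0ℚ
  shift F (suc j) = F j

  odd-t-*-t : ∀ F j → odd (t * (t * F)) j ≡ shift (odd F) j
  odd-t-*-t F zero    = ≡.trans (t-*-suc (t * F) 0) (t-*-zero F)
  odd-t-*-t F (suc j) = ≡.trans (t-*-suc (t * F) _) (t-*-suc F _)

  shift-cong : ∀ {F F′} → (∀ j → F j ≡ F′ j) → ∀ j → shift F j ≡ shift F′ j
  shift-cong p zero    = ≡.refl
  shift-cong p (suc j) = p j

  oddℚ : ℕ → ℚ
  oddℚ j = fromℕ (suc (double j))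

  -- This is `ode` at t^(2j+1). On the left, θ and t² preserve odd exponents, and t² becomes a shift
  -- by one in j. On the right, the single factor t turns them into the even exponents 2j.
  odd-ode : ∀ a i j →
    fromℕ 3 ℚ.* oddℚ j ℚ.* odd (y a i) j ℚ.+ shift (λ k → (oddℚ k ℚ.+ (a ℚ.+ a)) ℚ.* odd (y a i) k) j
    ≡ (fromℕ i ℚ.+ a) ℚ.* even (R a i) j ℚ.+ fromℕ 3 ℚ.* fromℕ i ℚ.* even (R a (ℕ.pred i)) j
  odd-ode a i j = begin
    fromℕ 3 ℚ.* oddℚ j ℚ.* odd Y j ℚ.+ shift (λ k → (oddℚ k ℚ.+ (a ℚ.+ a)) ℚ.* odd Y k) j
      ≡⟨ ≡.cong₂ ℚ._+_
           (≡.trans (ℚ.*-assoc (fromℕ 3) (oddℚ j) (odd Y j)) (≡.sym (const-* (fromℕ 3) (θ Y) (suc (double j)))))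
           (≡.trans (shift-cong (λ k → coefficients k) j) (≡.sym (odd-t-*-t (θ Y + (const a * Y + const a * Y)) j))) ⟩
    odd (const (fromℕ 3) * θ Y + t * (t * (θ Y + (const a * Y + const a * Y)))) j
      ≡⟨ at (ode a i) (suc (double j)) ⟩
    odd (t * ((const (fromℕ i) * R a i + const a * R a i) + const (fromℕ 3) * (const (fromℕ i) * R a (ℕ.pred i)))) j
      ≡⟨ t-*-suc ((const (fromℕ i) * R a i + const a * R a i) + const (fromℕ 3) * (const (fromℕ i) * R a (ℕ.pred i))) (double j) ⟩
    (const (fromℕ i) * R a i) k ℚ.+ (const a * R a i) k ℚ.+ (const (fromℕ 3) * (const (fromℕ i) * R a (ℕ.pred i))) k
      ≡⟨ ≡.cong₂ ℚ._+_ (≡.cong₂ ℚ._+_ (const-* (fromℕ i) (R a i) k) (const-* a (R a i) k))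
           (≡.trans (const-* (fromℕ 3) (const (fromℕ i) * R a (ℕ.pred i)) k) (≡.cong (fromℕ 3 ℚ.*_) (const-* (fromℕ i) (R a (ℕ.pred i)) k))) ⟩
    fromℕ i ℚ.* R a i k ℚ.+ a ℚ.* R a i k ℚ.+ fromℕ 3 ℚ.* (fromℕ i ℚ.* R a (ℕ.pred i) k)
      ≡⟨ ≡.cong₂ ℚ._+_ (≡.sym (ℚ.*-distribʳ-+ (R a i k) (fromℕ i) a)) (≡.sym (ℚ.*-assoc (fromℕ 3) (fromℕ i) (R a (ℕ.pred i) k))) ⟩
    (fromℕ i ℚ.+ a) ℚ.* even (R a i) j ℚ.+ fromℕ 3 ℚ.* fromℕ i ℚ.* even (R a (ℕ.pred i)) j ∎
    where
    open ≡.≡-Reasoning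
    Y = y a i
    k = double j
    coefficients : ∀ k → (oddℚ k ℚ.+ (a ℚ.+ a)) ℚ.* odd Y k ≡ odd (θ Y + (const a * Y + const a * Y)) k
    coefficients k = ≡.trans
      (solve 3 (λ w a y → (w :+ (a :+ a)) :* y := w :* y :+ (a :* y :+ a :* y)) ≡.refl (oddℚ k) a (odd Y k))
      (≡.cong (λ z → odd (θ Y) k ℚ.+ (z ℚ.+ z)) (≡.sym (const-* a Y (suc (double k)))))
      where open +-*-Solver

  -- The coefficients of 9 - 10 t² + t⁴ appear as three diagonals; the factor `1ℚ` is kept so that
  -- the right side has the shape required by `det-*-band`.
  even-R-suc : ∀ a i j → let ŷ = odd (y (a +3) i) in
    even (R a (suc i)) (suc j) ≡ fromℕ 9 ℚ.* ŷ j ℚ.+ shift (λ k → (ℚ.- fromℕ 10) ℚ.* ŷ k) j ℚ.+ shift (shift (λ k → 1ℚ ℚ.* ŷ k)) j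
  even-R-suc a i j = begin
    R a (suc i) (suc k)
      ≡⟨ at (R-suc a i) (suc k) ⟩
    (t * [1-t²][9-t²] ŷ) (suc k)
      ≡⟨ t-*-suc ([1-t²][9-t²] ŷ) k ⟩
    (const (fromℕ 9) * ŷ) k ℚ.+ (const (ℚ.- fromℕ 10) * (t * (t * ŷ))) k ℚ.+ (t * (t * (t * (t * ŷ)))) k
      ≡⟨ ≡.cong₂ ℚ._+_ (≡.cong₂ ℚ._+_ (const-* (fromℕ 9) ŷ k) middle)
           (≡.trans (odd-t-*-t (t * (t * ŷ)) j) (shift-cong (λ l → ≡.trans (odd-t-*-t ŷ l) (shift-cong (λ m → ≡.sym (ℚ.*-identityˡ (odd ŷ m))) l)) j)) ⟩
    fromℕ 9 ℚ.* odd ŷ j ℚ.+ shift (λ k → (ℚ.- fromℕ 10) ℚ.* odd ŷ k) j ℚ.+ shift (shift (λ k → 1ℚ ℚ.* odd ŷ k)) j ∎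
    where
    open ≡.≡-Reasoning
    ŷ = y (a +3) i
    k = suc (double j)
    shift-scale : ∀ c F j → c ℚ.* shift F j ≡ shift (λ k → c ℚ.* F k) j
    shift-scale c F zero    = ℚ.*-zeroʳ c
    shift-scale c F (suc j) = ≡.refl
    middle : (const (ℚ.- fromℕ 10) * (t * (t * ŷ))) k ≡ shift (λ k → (ℚ.- fromℕ 10) ℚ.* odd ŷ k) j
    middle = ≡.trans (const-* (ℚ.- fromℕ 10) (t * (t * ŷ)) k)
      (≡.trans (≡.cong ((ℚ.- fromℕ 10) ℚ.*_) (odd-t-*-t ŷ j)) (shift-scale (ℚ.- fromℕ 10) (odd ŷ) j))

  -- Matrices with three diagonals

  δ : ℕ → ℕ → ℚ
  δ zero    zero    = 1ℚ
  δ zero    (suc m) = 0ℚ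
  δ (suc k) zero    = 0ℚ
  δ (suc k) (suc m) = δ k m

  δ-diagonal : ∀ m → δ m m ≡ 1ℚ
  δ-diagonal zero    = ≡.refl
  δ-diagonal (suc m) = δ-diagonal m

  δ-lower : ∀ {k m} → m ℕ.< k → δ k m ≡ 0ℚ
  δ-lower {suc k} {zero}  _         = ≡.refl
  δ-lower {suc k} {suc m} (s<s m<k) = δ-lower m<k

  sum-δ : ∀ {n m} F → m ℕ.< n → sum {n} (λ k → F (toℕ k) ℚ.* δ (toℕ k) m) ≡ F m
  sum-δ {suc n} {zero}  F _ = ≡.trans (≡.cong₂ ℚ._+_ (ℚ.*-identityʳ (F 0)) (sum-zero {n} (λ k → ℚ.*-zeroʳ (F (suc (toℕ k)))))) (ℚ.+-identityʳ (F 0))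
  sum-δ {suc n} {suc m} F (s<s m<n) = ≡.trans (≡.cong₂ ℚ._+_ (ℚ.*-zeroʳ (F 0)) (sum-δ {n} (λ k → F (suc k)) m<n)) (ℚ.+-identityˡ (F (suc m)))

  sum-δ-suc : ∀ {n m} F → m ℕ.< n → sum {n} (λ k → F (toℕ k) ℚ.* δ (suc (toℕ k)) m) ≡ shift F m
  sum-δ-suc {n} {zero}  F _   = sum-zero {n} (λ k → ℚ.*-zeroʳ (F (toℕ k)))
  sum-δ-suc {n} {suc m} F m<n = sum-δ F (ℕ.<-trans (ℕ.n<1+n m) m<n)

  sum-δ-suc² : ∀ {n m} F → m ℕ.< n → sum {n} (λ k → F (toℕ k) ℚ.* δ (suc (suc (toℕ k))) m) ≡ shift (shift F) m
  sum-δ-suc² {n} {zero}  F _   = sum-zero {n} (λ k → ℚ.*-zeroʳ (F (toℕ k)))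
  sum-δ-suc² {n} {suc m} F m<n = sum-δ-suc F (ℕ.<-trans (ℕ.n<1+n m) m<n)

  -- Multiplying a row vector F on the right by this matrix combines the entries of F at m, m - 1
  -- and m - 2. The weights are indexed by the source k, not by the target m, which matches weights
  -- placed inside `shift`.
  band : (A B C : Series) → ℕ → ℕ → ℚ
  band A B C k m = A k ℚ.* δ k m ℚ.+ B k ℚ.* δ (suc k) m ℚ.+ C k ℚ.* δ (suc (suc k)) m

  band-lower : ∀ A B C {k m} → m ℕ.< k → band A B C k m ≡ 0ℚ
  band-lower A B C {k} {m} m<k = begin
    A k ℚ.* δ k m ℚ.+ B k ℚ.* δ (suc k) m ℚ.+ C k ℚ.* δ (suc (suc k)) m
      ≡⟨ ≡.cong₂ ℚ._+_ (≡.cong₂ ℚ._+_ (≡.cong (A k ℚ.*_) (δ-lower m<k)) (≡.cong (B k ℚ.*_) (δ-lower m<1+k)))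
           (≡.cong (C k ℚ.*_) (δ-lower (ℕ.m<n⇒m<1+n m<1+k))) ⟩
    A k ℚ.* 0ℚ ℚ.+ B k ℚ.* 0ℚ ℚ.+ C k ℚ.* 0ℚ
      ≡⟨ solve 3 (λ a b c → a :* con 0ℚ :+ b :* con 0ℚ :+ c :* con 0ℚ := con 0ℚ) ≡.refl (A k) (B k) (C k) ⟩
    0ℚ ∎
    where
    open ≡.≡-Reasoning
    open +-*-Solver
    m<1+k = ℕ.m<n⇒m<1+n m<k

  band-diagonal : ∀ A B C m → band A B C m m ≡ A m
  band-diagonal A B C m = begin
    A m ℚ.* δ m m ℚ.+ B m ℚ.* δ (suc m) m ℚ.+ C m ℚ.* δ (suc (suc m)) m
      ≡⟨ ≡.cong₂ ℚ._+_ (≡.cong₂ ℚ._+_ (≡.cong (A m ℚ.*_) (δ-diagonal m)) (≡.cong (B m ℚ.*_) (δ-lower (ℕ.n<1+n m))))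
           (≡.cong (C m ℚ.*_) (δ-lower (ℕ.m<n⇒m<1+n (ℕ.n<1+n m)))) ⟩
    A m ℚ.* 1ℚ ℚ.+ B m ℚ.* 0ℚ ℚ.+ C m ℚ.* 0ℚ
      ≡⟨ solve 3 (λ a b c → a :* con 1ℚ :+ b :* con 0ℚ :+ c :* con 0ℚ := a) ≡.refl (A m) (B m) (C m) ⟩
    A m ∎
    where
    open ≡.≡-Reasoning
    open +-*-Solver

  -- Cutting the sum off at n loses nothing, because the entry at m draws only on indices up to m <
  -- n.
  sum-band : ∀ {n m} (A B C F : Series) → m ℕ.< n → sum {n} (λ k → F (toℕ k) ℚ.* band A B C (toℕ k) m)
    ≡ A m ℚ.* F m ℚ.+ shift (λ k → B k ℚ.* F k) m ℚ.+ shift (shift (λ k → C k ℚ.* F k)) m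
  sum-band {n} {m} A B C F m<n = begin
    sum {n} (λ k → F (toℕ k) ℚ.* band A B C (toℕ k) m)
      ≡⟨ sum-cong-≗ {n} (λ k → rearrange (toℕ k)) ⟩
    sum (λ k → AF k ℚ.+ BF k ℚ.+ CF k)
      ≡⟨ ∑-distrib-+ (λ k → AF k ℚ.+ BF k) CF ⟩
    sum (λ k → AF k ℚ.+ BF k) ℚ.+ sum CF
      ≡⟨ ≡.cong (ℚ._+ sum CF) (∑-distrib-+ AF BF) ⟩
    sum AF ℚ.+ sum BF ℚ.+ sum CF
      ≡⟨ ≡.cong₂ ℚ._+_ (≡.cong₂ ℚ._+_ (sum-δ (λ k → A k ℚ.* F k) m<n) (sum-δ-suc (λ k → B k ℚ.* F k) m<n))
           (sum-δ-suc² (λ k → C k ℚ.* F k) m<n) ⟩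
    A m ℚ.* F m ℚ.+ shift (λ k → B k ℚ.* F k) m ℚ.+ shift (shift (λ k → C k ℚ.* F k)) m ∎
    where
    open ≡.≡-Reasoning
    AF BF CF : Fin n → ℚ
    AF k = A (toℕ k) ℚ.* F (toℕ k) ℚ.* δ (toℕ k) m
    BF k = B (toℕ k) ℚ.* F (toℕ k) ℚ.* δ (suc (toℕ k)) m
    CF k = C (toℕ k) ℚ.* F (toℕ k) ℚ.* δ (suc (suc (toℕ k))) m
    open +-*-Solver
    rearrange : ∀ k → F k ℚ.* band A B C k m ≡ A k ℚ.* F k ℚ.* δ k m ℚ.+ B k ℚ.* F k ℚ.* δ (suc k) m ℚ.+ C k ℚ.* F k ℚ.* δ (suc (suc k)) m
    rearrange k = solve 7 (λ f a b c x y z → f :* (a :* x :+ b :* y :+ c :* z) := a :* f :* x :+ b :* f :* y :+ c :* f :* z)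
      ≡.refl (F k) (A k) (B k) (C k) (δ k m) (δ (suc k) m) (δ (suc (suc k)) m)

  -- The recurrence for D

  D : ℕ → ℚ → ℚ
  D n a = det {n} (λ i j → odd (y a (toℕ i)) (toℕ j))

  det-*-band : ∀ n (A B C : Series) (M : Fin n → Series) →
    det {n} (λ i j → A (toℕ j) ℚ.* M i (toℕ j) ℚ.+ shift (λ k → B k ℚ.* M i k) (toℕ j) ℚ.+ shift (shift (λ k → C k ℚ.* M i k)) (toℕ j))
    ≡ ∏ {n} (λ j → A (toℕ j)) ℚ.* det {n} (λ i j → M i (toℕ j))
  det-*-band n A B C M = begin
    det {n} (λ i j → A (toℕ j) ℚ.* M i (toℕ j) ℚ.+ shift (λ k → B k ℚ.* M i k) (toℕ j) ℚ.+ shift (shift (λ k → C k ℚ.* M i k)) (toℕ j))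
      ≡⟨ det-cong {n} _ _ (λ i j → sum-band A B C (M i) (Fin.toℕ<n j)) ⟨
    det {n} (λ i j → sum {n} λ k → M i (toℕ k) ℚ.* band A B C (toℕ k) (toℕ j))
      ≡⟨ det-*-upperTriangular {n} (λ i j → M i (toℕ j)) (λ k j → band A B C (toℕ k) (toℕ j)) (λ k j → band-lower A B C) ⟩
    ∏ {n} (λ j → band A B C (toℕ j) (toℕ j)) ℚ.* det {n} (λ i j → M i (toℕ j))
      ≡⟨ ≡.cong (ℚ._* det {n} (λ i j → M i (toℕ j))) (product-cong {n} (λ j → band-diagonal A B C (toℕ j))) ⟩
    ∏ {n} (λ j → A (toℕ j)) ℚ.* det {n} (λ i j → M i (toℕ j)) ∎
    where open ≡.≡-Reasoning

  -- Here `M j` runs down column j, so the band combines rows; transposing before and after reduces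
  -- this to combining columns.
  det-band-* : ∀ n (A B C : Series) (M : Fin n → Series) →
    det {n} (λ i j → A (toℕ i) ℚ.* M j (toℕ i) ℚ.+ shift (λ k → B k ℚ.* M j k) (toℕ i) ℚ.+ shift (shift (λ k → C k ℚ.* M j k)) (toℕ i))
    ≡ ∏ {n} (λ j → A (toℕ j)) ℚ.* det {n} (λ i j → M j (toℕ i))
  det-band-* n A B C M = begin
    det (λ i j → N j i)                                                     ≡⟨ det-transpose n N ⟩
    det N                                                                   ≡⟨ det-*-band n A B C M ⟩
    ∏ {n} (λ j → A (toℕ j)) ℚ.* det {n} (λ i j → M i (toℕ j))         ≡⟨ ≡.cong (∏ {n} (λ j → A (toℕ j)) ℚ.*_) (det-transpose n (λ i j → M i (toℕ j))) ⟨
    ∏ {n} (λ j → A (toℕ j)) ℚ.* det {n} (λ i j → M j (toℕ i))         ∎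
    where
    open ≡.≡-Reasoning
    N : Matrix n
    N i j = A (toℕ j) ℚ.* M i (toℕ j) ℚ.+ shift (λ k → B k ℚ.* M i k) (toℕ j) ℚ.+ shift (shift (λ k → C k ℚ.* M i k)) (toℕ j)

  shift-zero : ∀ (F : Series) j → shift (shift (λ k → 0ℚ ℚ.* F k)) j ≡ 0ℚ
  shift-zero F zero          = ≡.refl
  shift-zero F (suc zero)    = ≡.refl
  shift-zero F (suc (suc j)) = ℚ.*-zeroˡ (F j)

  -- One matrix is evaluated in two ways. The left side of `odd-ode` presents it as column
  -- operations on the odd coefficients of the yᵢ, the right side as row operations on the even
  -- coefficients of the Rᵢ.
  D-recurrence : ∀ n a →
    ∏ {suc n} (λ j → fromℕ 3 ℚ.* oddℚ (toℕ j)) ℚ.* D (suc n) a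
    ≡ ∏ {suc n} (λ i → fromℕ (toℕ i) ℚ.+ a) ℚ.* (fromℕ 3 ℚ.* (∏ {n} (λ _ → fromℕ 9) ℚ.* D n (a +3)))
  D-recurrence n a = begin
    ∏ {suc n} (λ j → fromℕ 3 ℚ.* oddℚ (toℕ j)) ℚ.* D (suc n) a
      -- Both bands here have only two diagonals, so the third weight is 0 and `shift-zero` disposes
      -- of it.
      ≡⟨ det-*-band (suc n) (λ j → fromℕ 3 ℚ.* oddℚ j) (λ k → oddℚ k ℚ.+ (a ℚ.+ a)) (λ _ → 0ℚ) (λ i → odd (y a (toℕ i))) ⟨
    det {suc n} (λ i j → (fromℕ 3 ℚ.* oddℚ (toℕ j)) ℚ.* odd (y a (toℕ i)) (toℕ j)
        ℚ.+ shift (λ k → (oddℚ k ℚ.+ (a ℚ.+ a)) ℚ.* odd (y a (toℕ i)) k) (toℕ j)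
        ℚ.+ shift (shift (λ k → 0ℚ ℚ.* odd (y a (toℕ i)) k)) (toℕ j))
      ≡⟨ det-cong {suc n} _ _ (λ i j → entry (toℕ i) (toℕ j)) ⟩
    det {suc n} (λ i j → (fromℕ (toℕ i) ℚ.+ a) ℚ.* even (R a (toℕ i)) (toℕ j)
        ℚ.+ shift (λ k → fromℕ 3 ℚ.* fromℕ (suc k) ℚ.* even (R a k) (toℕ j)) (toℕ i)
        ℚ.+ shift (shift (λ k → 0ℚ ℚ.* even (R a k) (toℕ j))) (toℕ i))
      ≡⟨ det-band-* (suc n) (λ i → fromℕ i ℚ.+ a) (λ k → fromℕ 3 ℚ.* fromℕ (suc k)) (λ _ → 0ℚ) (λ j k → even (R a k) (toℕ j)) ⟩
    ∏ {suc n} (λ i → fromℕ (toℕ i) ℚ.+ a) ℚ.* det {suc n} (λ i j → even (R a (toℕ i)) (toℕ j))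
      ≡⟨ ≡.cong (∏ {suc n} (λ i → fromℕ (toℕ i) ℚ.+ a) ℚ.*_) det-R ⟩
    ∏ {suc n} (λ i → fromℕ (toℕ i) ℚ.+ a) ℚ.* (fromℕ 3 ℚ.* (∏ {n} (λ _ → fromℕ 9) ℚ.* D n (a +3))) ∎
    where
    open ≡.≡-Reasoning

    entry : ∀ i j →
      (fromℕ 3 ℚ.* oddℚ j) ℚ.* odd (y a i) j ℚ.+ shift (λ k → (oddℚ k ℚ.+ (a ℚ.+ a)) ℚ.* odd (y a i) k) j
        ℚ.+ shift (shift (λ k → 0ℚ ℚ.* odd (y a i) k)) j
      ≡ (fromℕ i ℚ.+ a) ℚ.* even (R a i) j ℚ.+ shift (λ k → fromℕ 3 ℚ.* fromℕ (suc k) ℚ.* even (R a k) j) i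
        ℚ.+ shift (shift (λ k → 0ℚ ℚ.* even (R a k) j)) i
    entry i j = ≡.cong₂ ℚ._+_
      (≡.trans (odd-ode a i j) (≡.cong ((fromℕ i ℚ.+ a) ℚ.* even (R a i) j ℚ.+_) (lastTerm i)))
      (≡.trans (shift-zero (odd (y a i)) j) (≡.sym (shift-zero (λ k → even (R a k) j) i)))
      where
      lastTerm : ∀ i → fromℕ 3 ℚ.* fromℕ i ℚ.* even (R a (ℕ.pred i)) j ≡ shift (λ k → fromℕ 3 ℚ.* fromℕ (suc k) ℚ.* even (R a k) j) i
      lastTerm zero    = ℚ.*-zeroˡ (even (R a 0) j)
      lastTerm (suc i) = ≡.refl

    -- Every Rᵢ₊₁ is divisible by t, so column 0 contains only the constant term 3 of R₀. In the
    -- remaining minor, 9 - 10 t² + t⁴ acts on the columns with diagonal 9.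
    det-R : det {suc n} (λ i j → even (R a (toℕ i)) (toℕ j)) ≡ fromℕ 3 ℚ.* (∏ {n} (λ _ → fromℕ 9) ℚ.* D n (a +3))
    det-R = begin
      det {suc n} (λ i j → even (R a (toℕ i)) (toℕ j))
        ≡⟨ det-firstColumn {n} (λ i j → even (R a (toℕ i)) (toℕ j)) (λ i → ≡.trans (at (R-suc a (toℕ i)) 0) (t-*-zero ([1-t²][9-t²] y (a +3) (toℕ i)))) ⟩
      fromℕ 3 ℚ.* det {n} (λ i j → even (R a (suc (toℕ i))) (suc (toℕ j)))
        ≡⟨ ≡.cong (fromℕ 3 ℚ.*_) (det-cong {n} _ _ (λ i j → even-R-suc a (toℕ i) (toℕ j))) ⟩
      fromℕ 3 ℚ.* det {n} (λ i j → let ŷ = odd (y (a +3) (toℕ i)) in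
        fromℕ 9 ℚ.* ŷ (toℕ j) ℚ.+ shift (λ k → (ℚ.- fromℕ 10) ℚ.* ŷ k) (toℕ j) ℚ.+ shift (shift (λ k → 1ℚ ℚ.* ŷ k)) (toℕ j))
        ≡⟨ ≡.cong (fromℕ 3 ℚ.*_) (det-*-band n (λ _ → fromℕ 9) (λ _ → ℚ.- fromℕ 10) (λ _ → 1ℚ) (λ i → odd (y (a +3) (toℕ i)))) ⟩
      fromℕ 3 ℚ.* (∏ {n} (λ _ → fromℕ 9) ℚ.* D n (a +3)) ∎

  -- From the binomial entries to the powers of b

  -- The powers uⁱ and vⁱ of the overview, already multiplied by (1 - t)⁻ᵃ.
  u v p : ℚ → ℕ → Series
  u a zero    = G a
  u a (suc i) = const (fromℕ 4) * (h * u a i)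
  v a zero    = G a
  v a (suc i) = 1-t * v a i
  p a i = u a i + v a i

  -- Power sums satisfy sᵢ₊₂ = (u + v) sᵢ₊₁ - u v sᵢ, here with u + v = b + 5 and u v = 4. The
  -- cofactor comes from u + v - (b + 5) = (4 + t) ((1 - t) h - 1) and u v - 4 = 4 ((1 - t) h - 1).
  p-suc² : ∀ a i → p a (suc (suc i)) ≈ b * p a (suc i) + const (fromℕ 5) * p a (suc i) + const (ℚ.- fromℕ 4) * p a i
  p-suc² a i = mod-1-t-*-h ((const (fromℕ 4) + t) * p a (suc i) + const (ℚ.- fromℕ 4) * p a i)
    (solve 4 (λ t h u v →
      p² t h u v :+ ((con (fromℕ 4) :+ t) :* p¹ t h u v :+ con (ℚ.- fromℕ 4) :* (u :+ v))
      := t :* (con (fromℕ 3) :+ t) :* h :* p¹ t h u v :+ con (fromℕ 5) :* p¹ t h u v :+ con (ℚ.- fromℕ 4) :* (u :+ v)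
         :+ ((con (fromℕ 4) :+ t) :* p¹ t h u v :+ con (ℚ.- fromℕ 4) :* (u :+ v)) :* ((con 1ℚ :+ (:- t)) :* h))
      refl t h (u a i) (v a i))
    where
    open Solver
    p¹ p² : ∀ {n} (t h u v : Polynomial n) → Polynomial n
    p¹ t h u v = con (fromℕ 4) :* (h :* u) :+ (con 1ℚ :+ (:- t)) :* v
    p² t h u v = con (fromℕ 4) :* (h :* (con (fromℕ 4) :* (h :* u))) :+ (con 1ℚ :+ (:- t)) :* ((con 1ℚ :+ (:- t)) :* v)

  p-1 : ∀ a → p a 1 ≈ const (fromℕ 5) * y a 0 + const 1ℚ * y a 1
  p-1 a = mod-1-t-*-h ((const (fromℕ 4) + t) * G a)
    (solve 3 (λ t h g →
      con (fromℕ 4) :* (h :* g) :+ (con 1ℚ :+ (:- t)) :* g :+ (con (fromℕ 4) :+ t) :* g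
      := con (fromℕ 5) :* g :+ con 1ℚ :* (t :* (con (fromℕ 3) :+ t) :* h :* g)
         :+ (con (fromℕ 4) :+ t) :* g :* ((con 1ℚ :+ (:- t)) :* h))
      refl t h (G a))
    where open Solver

  combination : ℕ → (ℕ → ℚ) → (ℕ → Series) → Series
  combination zero    c Y = const 0ℚ
  combination (suc n) c Y = const (c 0) * Y 0 + combination n (c ∘ suc) (Y ∘ suc)

  combination-at : ∀ n c Y k → combination n c Y k ≡ sum {n} (λ l → c (toℕ l) ℚ.* Y (toℕ l) k)
  combination-at zero    c Y zero    = ≡.refl
  combination-at zero    c Y (suc k) = ≡.refl
  combination-at (suc n) c Y k = ≡.cong₂ ℚ._+_ (const-* (c 0) (Y 0) k) (combination-at n (c ∘ suc) (Y ∘ suc) k)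

  combination-* : ∀ F n c Y → combination n c (λ l → F * Y l) ≈ F * combination n c Y
  combination-* F zero    c Y = solve 1 (λ F → con 0ℚ := F :* con 0ℚ) refl F
    where open Solver
  combination-* F (suc n) c Y = trans (+-congˡ {const (c 0) * (F * Y 0)} (combination-* F n (c ∘ suc) (Y ∘ suc)))
    (solve 4 (λ F c y z → c :* (F :* y) :+ F :* z := F :* (c :* y :+ z)) refl F (const (c 0)) (Y 0) (combination n (c ∘ suc) (Y ∘ suc)))
    where open Solver

  combination-linear : ∀ α β n (c d e : ℕ → ℚ) Y →
    combination n (λ l → c l ℚ.+ α ℚ.* d l ℚ.+ β ℚ.* e l) Y
    ≈ combination n c Y + const α * combination n d Y + const β * combination n e Y
  combination-linear α β zero    c d e Y = solve 2 (λ α β → con 0ℚ := con 0ℚ :+ α :* con 0ℚ :+ β :* con 0ℚ) refl (const α) (const β)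
    where open Solver
  combination-linear α β (suc n) c d e Y = trans
    (+-cong (*-congʳ {Y 0} (trans (+-homo (c 0 ℚ.+ α ℚ.* d 0) (β ℚ.* e 0))
        (+-cong (trans (+-homo (c 0) (α ℚ.* d 0)) (+-congˡ {const (c 0)} (*-homo α (d 0)))) (*-homo β (e 0)))))
      (combination-linear α β n (c ∘ suc) (d ∘ suc) (e ∘ suc) (Y ∘ suc)))
    (solve 9 (λ α β c d e y x z w → (c :+ α :* d :+ β :* e) :* y :+ (x :+ α :* z :+ β :* w)
       := (c :* y :+ x) :+ α :* (d :* y :+ z) :+ β :* (e :* y :+ w)) refl
      (const α) (const β) (const (c 0)) (const (d 0)) (const (e 0)) (Y 0)
      (combination n (c ∘ suc) (Y ∘ suc)) (combination n (d ∘ suc) (Y ∘ suc)) (combination n (e ∘ suc) (Y ∘ suc)))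
    where open Solver

  combination-zero : ∀ n Y → combination n (λ _ → 0ℚ) Y ≈ const 0ℚ
  combination-zero zero    Y = refl
  combination-zero (suc n) Y = trans (+-congˡ {const 0ℚ * Y 0} (combination-zero n (Y ∘ suc)))
    (solve 1 (λ y → con 0ℚ :* y :+ con 0ℚ := con 0ℚ) refl (Y 0))
    where open Solver

  -- uⁱ + vⁱ = Σₗ P i l (u + v - 5)ˡ whenever u v = 4.
  P : ℕ → ℕ → ℚ
  P zero          zero          = fromℕ 2
  P zero          (suc l)       = 0ℚ
  P (suc zero)    zero          = fromℕ 5
  P (suc zero)    (suc zero)    = 1ℚ
  P (suc zero)    (suc (suc l)) = 0ℚ
  P (suc (suc i)) l             = shift (P (suc i)) l ℚ.+ fromℕ 5 ℚ.* P (suc i) l ℚ.+ (ℚ.- fromℕ 4) ℚ.* P i l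

  p≈combination : ∀ a i n → i ℕ.< n → p a i ≈ combination n (P i) (y a)
  p≈combination a zero (suc n) _ = trans
    (solve 1 (λ g → g :+ g := con (fromℕ 2) :* g :+ con 0ℚ) refl (G a))
    (+-congˡ {const (fromℕ 2) * G a} (sym (combination-zero n (y a ∘ suc))))
    where open Solver
  p≈combination a (suc zero) (suc zero) (s≤s ())
  p≈combination a (suc zero) (suc (suc n)) _ = trans (p-1 a)
    (+-congˡ {const (fromℕ 5) * y a 0} (trans
      (solve 1 (λ z → z := z :+ con 0ℚ) refl (const 1ℚ * y a 1))
      (+-congˡ {const 1ℚ * y a 1} (sym (combination-zero n (λ l → y a (suc (suc l))))))))
    where open Solver
  p≈combination a (suc (suc i)) (suc n) (s≤s 1+i<n) = begin
    p a (suc (suc i))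
      ≈⟨ p-suc² a i ⟩
    b * p a (suc i) + const (fromℕ 5) * p a (suc i) + const (ℚ.- fromℕ 4) * p a i
      -- The first summand is expanded with n terms only: multiplication by b moves each yₗ to yₗ₊₁
      -- and so fills n + 1 places.
      ≈⟨ +-cong (+-cong (*-congˡ {b} (p≈combination a (suc i) n 1+i<n))
                        (*-congˡ {const (fromℕ 5)} (p≈combination a (suc i) (suc n) (ℕ.m<n⇒m<1+n 1+i<n))))
                (*-congˡ {const (ℚ.- fromℕ 4)} (p≈combination a i (suc n) (ℕ.m<n⇒m<1+n (ℕ.<-trans (ℕ.n<1+n i) 1+i<n)))) ⟩
    b * combination n (P (suc i)) (y a) + const (fromℕ 5) * combination (suc n) (P (suc i)) (y a)
      + const (ℚ.- fromℕ 4) * combination (suc n) (P i) (y a)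
      ≈⟨ +-congʳ {const (ℚ.- fromℕ 4) * combination (suc n) (P i) (y a)}
           (+-congʳ {const (fromℕ 5) * combination (suc n) (P (suc i)) (y a)} shifted) ⟨
    combination (suc n) (shift (P (suc i))) (y a) + const (fromℕ 5) * combination (suc n) (P (suc i)) (y a)
      + const (ℚ.- fromℕ 4) * combination (suc n) (P i) (y a)
      ≈⟨ combination-linear (fromℕ 5) (ℚ.- fromℕ 4) (suc n) (shift (P (suc i))) (P (suc i)) (P i) (y a) ⟨
    combination (suc n) (P (suc (suc i))) (y a) ∎
    where
    open SetoidReasoning setoid
    open Solver
    shifted : combination (suc n) (shift (P (suc i))) (y a) ≈ b * combination n (P (suc i)) (y a)
    shifted = trans (solve 2 (λ g z → con 0ℚ :* g :+ z := z) refl (G a) (combination n (P (suc i)) (λ l → b * y a l)))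
      (combination-* b n (P (suc i)) (y a))

  P-upper : ∀ i {l} → i ℕ.< l → P i l ≡ 0ℚ
  P-upper zero          {suc l}       _         = ≡.refl
  P-upper (suc zero)    {suc zero}    (s≤s ())
  P-upper (suc zero)    {suc (suc l)} _         = ≡.refl
  P-upper (suc (suc i)) {suc l}       (s≤s i<l) = ≡.cong₂ ℚ._+_
    (≡.cong₂ ℚ._+_ (P-upper (suc i) i<l) (≡.cong (fromℕ 5 ℚ.*_) (P-upper (suc i) (ℕ.m<n⇒m<1+n i<l))))
    (≡.cong ((ℚ.- fromℕ 4) ℚ.*_) (P-upper i (ℕ.m<n⇒m<1+n (ℕ.<-trans (ℕ.n<1+n i) i<l))))

  P-diagonal : ∀ i → P (suc i) (suc i) ≡ 1ℚ
  P-diagonal zero    = ≡.refl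
  P-diagonal (suc i) = ≡.cong₂ ℚ._+_
    (≡.cong₂ ℚ._+_ (P-diagonal i) (≡.cong (fromℕ 5 ℚ.*_) (P-upper (suc i) (ℕ.n<1+n (suc i)))))
    (≡.cong ((ℚ.- fromℕ 4) ℚ.*_) (P-upper i (ℕ.m<n⇒m<1+n (ℕ.n<1+n i))))

  -- The factor 2 is the corner entry `P 0 0`, all other diagonal entries being 1. A row 0 must
  -- exist for this, hence the size `suc n`.
  det-p : ∀ n a → det {suc n} (λ i j → odd (p a (toℕ i)) (toℕ j)) ≡ fromℕ 2 ℚ.* D (suc n) a
  det-p n a = begin
    det {suc n} (λ i j → odd (p a (toℕ i)) (toℕ j))
      ≡⟨ det-cong {suc n} _ _ (λ i j → ≡.trans (at (p≈combination a (toℕ i) (suc n) (Fin.toℕ<n i)) (suc (double (toℕ j))))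
           (combination-at (suc n) (P (toℕ i)) (y a) (suc (double (toℕ j))))) ⟩
    det {suc n} (λ i j → sum {suc n} λ l → P (toℕ i) (toℕ l) ℚ.* odd (y a (toℕ l)) (toℕ j))
      ≡⟨ det-lowerTriangular-* {suc n} (λ i l → P (toℕ i) (toℕ l)) (λ l j → odd (y a (toℕ l)) (toℕ j)) (λ i l i<l → P-upper (toℕ i) i<l) ⟩
    ∏ {suc n} (λ i → P (toℕ i) (toℕ i)) ℚ.* D (suc n) a
      ≡⟨ ≡.cong (λ z → fromℕ 2 ℚ.* z ℚ.* D (suc n) a) (≡.trans (product-cong {n} (λ i → P-diagonal (toℕ i))) (product-replicate-one n)) ⟩
    fromℕ 2 ℚ.* 1ℚ ℚ.* D (suc n) a
      ≡⟨⟩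
    fromℕ 2 ℚ.* D (suc n) a ∎
    where open ≡.≡-Reasoning

  u-G : ∀ a i → u a i ≈ const (fromℕ (4 ℕ.^ i)) * G (a ℚ.+ fromℕ i)
  u-G a zero    = trans (coefficientwise λ k → ≡.cong (λ c → G c k) (≡.sym (ℚ.+-identityʳ a)))
    (solve 1 (λ g → g := con 1ℚ :* g) refl (G (a ℚ.+ 0ℚ)))
    where open Solver
  u-G a (suc i) = begin
    const (fromℕ 4) * (h * u a i)
      ≈⟨ *-congˡ {const (fromℕ 4)} (*-congˡ {h} (u-G a i)) ⟩
    const (fromℕ 4) * (h * (const (fromℕ (4 ℕ.^ i)) * g))
      ≈⟨ solve 4 (λ f h c g → f :* (h :* (c :* g)) := (f :* c) :* (h :* g)) refl (const (fromℕ 4)) h (const (fromℕ (4 ℕ.^ i))) g ⟩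
    const (fromℕ 4) * const (fromℕ (4 ℕ.^ i)) * (h * g)
      ≈⟨ *-cong (trans (sym (*-homo (fromℕ 4) (fromℕ (4 ℕ.^ i))))
                  (coefficientwise λ k → ≡.cong (λ c → const c k) (≡.sym (fromℕ-* 4 (4 ℕ.^ i)))))
                (trans (sym (G-+1 (a ℚ.+ fromℕ i))) (coefficientwise λ k → ≡.cong (λ c → G c k) argument)) ⟩
    const (fromℕ (4 ℕ.^ suc i)) * G (a ℚ.+ fromℕ (suc i)) ∎
    where
    open SetoidReasoning setoid
    open Solver
    g = G (a ℚ.+ fromℕ i)
    argument : a ℚ.+ fromℕ i ℚ.+ 1ℚ ≡ a ℚ.+ fromℕ (suc i)
    argument = ≡.trans (ℚ.+-assoc a (fromℕ i) 1ℚ) (≡.cong (a ℚ.+_) (≡.trans (ℚ.+-comm (fromℕ i) 1ℚ) (≡.sym (fromℕ-suc i))))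

  v-G : ∀ a i → v a i ≈ G (a ℚ.- fromℕ i)
  v-G a zero    = coefficientwise λ k → ≡.cong (λ c → G c k) (≡.sym (ℚ.+-identityʳ a))
  v-G a (suc i) = trans (*-congˡ {1-t} (trans (v-G a i) (coefficientwise λ k → ≡.cong (λ c → G c k) argument)))
    (1-t-*-G (a ℚ.- fromℕ (suc i)))
    where
    open +-*-Solver
    argument : a ℚ.- fromℕ i ≡ a ℚ.- fromℕ (suc i) ℚ.+ 1ℚ
    argument = ≡.trans
      (solve 2 (λ a n → a :- n := a :- (con 1ℚ :+ n) :+ con 1ℚ) ≡.refl a (fromℕ i))
      (≡.cong (λ n → a ℚ.- n ℚ.+ 1ℚ) (≡.sym (fromℕ-suc i)))

open DeterminantRecurrence using (G; G-unique; D; D-recurrence; oddℚ; double; odd; _+3; p; det-p; u-G; v-G)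
open PowerSeries using (at; const-*)
open List using ([]; _∷_; length)
open Defs
open import Data.Nat.Combinatorics using (_C_; nCk+nC[k+1]≡[n+1]C[k+1]; nC1≡n)
open RawSemiringDefs (RawRing.rawSemiring ℚ[x]-rawRing) using () renaming (sum to sumₚ; _^_ to _^ₚ_)
open ≡ using (refl; cong; cong₂; sym; trans)
open ≡.≡-Reasoning

-- Polynomials are determined by their values

ev : ℚ[x] → ℚ → ℚ
ev []      q = 0ℚ
ev (a ∷ p) q = a ℚ.+ q ℚ.* ev p q

ev-+ : ∀ p r q → ev (p + r) q ≡ ev p q ℚ.+ ev r q
ev-+ []      r       q = sym (ℚ.+-identityˡ (ev r q))
ev-+ (a ∷ p) []      q = sym (ℚ.+-identityʳ (ev (a ∷ p) q))
ev-+ (a ∷ p) (b ∷ r) q = trans (cong (λ z → a ℚ.+ b ℚ.+ q ℚ.* z) (ev-+ p r q))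
  (solve 5 (λ a b q x y → a :+ b :+ q :* (x :+ y) := (a :+ q :* x) :+ (b :+ q :* y)) refl a b q (ev p q) (ev r q))
  where open +-*-Solver

ev-scale : ∀ c p q → ev (List.map (c ℚ.*_) p) q ≡ c ℚ.* ev p q
ev-scale c []      q = sym (ℚ.*-zeroʳ c)
ev-scale c (a ∷ p) q = trans (cong (λ z → c ℚ.* a ℚ.+ q ℚ.* z) (ev-scale c p q))
  (solve 4 (λ c a q x → c :* a :+ q :* (c :* x) := c :* (a :+ q :* x)) refl c a q (ev p q))
  where open +-*-Solver

ev-* : ∀ p r q → ev (p * r) q ≡ ev p q ℚ.* ev r q
ev-* []      r q = sym (ℚ.*-zeroˡ (ev r q))
ev-* (a ∷ p) r q = begin
  ev (List.map (a ℚ.*_) r + (0ℚ ∷ (p * r))) q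
    ≡⟨ ev-+ (List.map (a ℚ.*_) r) (0ℚ ∷ (p * r)) q ⟩
  ev (List.map (a ℚ.*_) r) q ℚ.+ (0ℚ ℚ.+ q ℚ.* ev (p * r) q)
    ≡⟨ cong₂ (λ y z → y ℚ.+ (0ℚ ℚ.+ q ℚ.* z)) (ev-scale a r q) (ev-* p r q) ⟩
  a ℚ.* ev r q ℚ.+ (0ℚ ℚ.+ q ℚ.* (ev p q ℚ.* ev r q))
    ≡⟨ solve 4 (λ a q x y → a :* y :+ (con 0ℚ :+ q :* (x :* y)) := (a :+ q :* x) :* y) refl a q (ev p q) (ev r q) ⟩
  ev (a ∷ p) q ℚ.* ev r q ∎
  where open +-*-Solver

ev-- : ∀ p q → ev (- p) q ≡ ℚ.- ev p q
ev-- []      q = refl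
ev-- (a ∷ p) q = trans (cong (λ z → ℚ.- a ℚ.+ q ℚ.* z) (ev-- p q))
  (solve 3 (λ a q x → :- a :+ q :* (:- x) := :- (a :+ q :* x)) refl a q (ev p q))
  where open +-*-Solver

ev-const : ∀ a q → ev (const a) q ≡ a
ev-const a q = solve 2 (λ a q → a :+ q :* con 0ℚ := a) refl a q
  where open +-*-Solver

ev-x : ∀ q → ev x q ≡ q
ev-x q = solve 1 (λ q → con 0ℚ :+ q :* (con 1ℚ :+ q :* con 0ℚ) := q) refl q
  where open +-*-Solver

ev-sum : ∀ {n} (f : Vector ℚ[x] n) q → ev (sumₚ f) q ≡ sum (λ i → ev (f i) q)
ev-sum {zero}  f q = refl
ev-sum {suc n} f q = trans (ev-+ (f zero) _ q) (cong (ev (f zero) q ℚ.+_) (ev-sum (λ i → f (suc i)) q))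

ev-product : ∀ {n} (f : Vector ℚ[x] n) q → ev (product f) q ≡ ∏ (λ i → ev (f i) q)
ev-product {zero}  f q = ev-const 1ℚ q
ev-product {suc n} f q = trans (ev-* (f zero) _ q) (cong (ev (f zero) q ℚ.*_) (ev-product (λ i → f (suc i)) q))

ev-^ : ∀ p n q → ev (p ^ₚ n) q ≡ ev p q ^ℚ n
ev-^ p zero    q = ev-const 1ℚ q
ev-^ p (suc n) q = trans (ev-* p (p ^ₚ n) q) (cong (ev p q ℚ.*_) (ev-^ p n q))

ev-det : ∀ {n} (M : Vector (Vector ℚ[x] n) n) q →
  ev (det M) q ≡ detℚ (λ i j → ev (M i j) q)
ev-det {zero}  M q = ev-const 1ℚ q
ev-det {suc n} M q = trans (ev-sum expand q) (sum-cong-≗ {suc n} λ j → begin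
  ev (expand j) q
    ≡⟨ ev-* ((- 1#) ^ₚ toℕ j * M zero j) (det (minor j)) q ⟩
  ev ((- 1#) ^ₚ toℕ j * M zero j) q ℚ.* ev (det (minor j)) q
    ≡⟨ cong₂ ℚ._*_ (trans (ev-* ((- 1#) ^ₚ toℕ j) (M zero j) q)
         (cong (ℚ._* ev (M zero j) q) (trans (ev-^ (- 1#) (toℕ j) q) (cong (_^ℚ toℕ j) (ev-const (ℚ.- 1ℚ) q)))))
         (ev-det (minor j) q) ⟩
  (ℚ.- 1ℚ) ^ℚ toℕ j ℚ.* ev (M zero j) q ℚ.* detℚ (λ i k → ev (minor j i k) q) ∎)
  where
  minor : Fin (suc n) → Vector (Vector ℚ[x] n) n
  minor j i k = M (suc i) (punchIn j k)

  expand : Fin (suc n) → ℚ[x]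
  expand j = (- 1#) ^ₚ toℕ j * M zero j * det (minor j)

-- For p = a ∷ p′, the coefficients of (p(x) - p(c)) / (x - c) are obtained by Horner's scheme from p′.
quotient : ℚ[x] → ℚ → ℚ[x]
quotient []      c = []
quotient (a ∷ p) c = ev (a ∷ p) c ∷ quotient p c

-- The left side is the difference of the values of `a ∷ p` at q and c for every constant term a,
-- since a cancels; this is why Horner's scheme ignores it.
ev-quotient : ∀ p c q → q ℚ.* ev p q ℚ.- c ℚ.* ev p c ≡ (q ℚ.- c) ℚ.* ev (quotient p c) q
ev-quotient []      c q = solve 2 (λ c q → q :* con 0ℚ :- c :* con 0ℚ := (q :- c) :* con 0ℚ) refl c q
  where open +-*-Solver
ev-quotient (a ∷ p) c q = begin
  q ℚ.* (a ℚ.+ q ℚ.* ev p q) ℚ.- c ℚ.* (a ℚ.+ c ℚ.* ev p c)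
    ≡⟨ solve 5 (λ a c q x y → q :* (a :+ q :* x) :- c :* (a :+ c :* y)
         := (q :- c) :* (a :+ c :* y) :+ q :* (q :* x :- c :* y)) refl a c q (ev p q) (ev p c) ⟩
  (q ℚ.- c) ℚ.* ev (a ∷ p) c ℚ.+ q ℚ.* (q ℚ.* ev p q ℚ.- c ℚ.* ev p c)
    ≡⟨ cong (λ z → (q ℚ.- c) ℚ.* ev (a ∷ p) c ℚ.+ q ℚ.* z) (ev-quotient p c q) ⟩
  (q ℚ.- c) ℚ.* ev (a ∷ p) c ℚ.+ q ℚ.* ((q ℚ.- c) ℚ.* ev (quotient p c) q)
    ≡⟨ solve 4 (λ d q x y → d :* x :+ q :* (d :* y) := d :* (x :+ q :* y)) refl (q ℚ.- c) q (ev (a ∷ p) c) (ev (quotient p c) q) ⟩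
  (q ℚ.- c) ℚ.* ev (quotient (a ∷ p) c) q ∎
  where open +-*-Solver

length-quotient : ∀ p c → length (quotient p c) ≡ length p
length-quotient []      c = refl
length-quotient (a ∷ p) c = cong suc (length-quotient p c)

IsZero : ℚ[x] → Set
IsZero p = ∀ k → coeff p k ≡ 0ℚ

ev-zero : ∀ p q → IsZero p → ev p q ≡ 0ℚ
ev-zero []      q _   = refl
ev-zero (a ∷ p) q p≡0 = begin
  a ℚ.+ q ℚ.* ev p q    ≡⟨ cong₂ (λ y z → y ℚ.+ q ℚ.* z) (p≡0 0) (ev-zero p q (λ k → p≡0 (suc k))) ⟩
  0ℚ ℚ.+ q ℚ.* 0ℚ       ≡⟨ trans (ℚ.+-identityˡ (q ℚ.* 0ℚ)) (ℚ.*-zeroʳ q) ⟩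
  0ℚ                    ∎

∷-zero : ∀ a p q → ev (a ∷ p) q ≡ 0ℚ → IsZero p → IsZero (a ∷ p)
∷-zero a p q eq p≡0 zero    = begin
  a                      ≡⟨ solve 2 (λ a q → a := a :+ q :* con 0ℚ) refl a q ⟩
  a ℚ.+ q ℚ.* 0ℚ         ≡⟨ cong (λ z → a ℚ.+ q ℚ.* z) (ev-zero p q p≡0) ⟨
  ev (a ∷ p) q           ≡⟨ eq ⟩
  0ℚ                     ∎
  where open +-*-Solver
∷-zero a p q eq p≡0 (suc k) = p≡0 k

quotient-zero : ∀ p c → IsZero (quotient p c) → IsZero p
quotient-zero []      c _   = λ _ → refl
quotient-zero (a ∷ p) c q≡0 = ∷-zero a p c (q≡0 0) (quotient-zero p c (λ k → q≡0 (suc k)))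

-- The root N is divided out, and the quotient still vanishes at N + 1, N + 2, ..., whose distances
-- from N are nonzero. The recursion follows the bound n because the quotient is shorter than the
-- polynomial without being a subterm of it.
vanishing⇒zero : ∀ n p → length p ℕ.≤ n → ∀ N → (∀ m → ev p (fromℕ (m ℕ.+ N)) ≡ 0ℚ) → IsZero p
vanishing⇒zero n       []      _           N _     = λ _ → refl
vanishing⇒zero (suc n) (a ∷ p) (s≤s |p|≤n) N roots = ∷-zero a p c (roots 0) (quotient-zero p c
  (vanishing⇒zero n (quotient p c) (ℕ.≤-trans (ℕ.≤-reflexive (length-quotient p c)) |p|≤n) (suc N) roots′))
  where
  open +-*-Solver
  c = fromℕ N

  roots′ : ∀ m → ev (quotient p c) (fromℕ (m ℕ.+ suc N)) ≡ 0ℚ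
  roots′ m = *-cancelˡ-fromℕ (suc m) (begin
    fromℕ (suc m) ℚ.* ev (quotient p c) q
      ≡⟨ cong (ℚ._* ev (quotient p c) q) difference ⟩
    (q ℚ.- c) ℚ.* ev (quotient p c) q
      ≡⟨ ev-quotient p c q ⟨
    q ℚ.* ev p q ℚ.- c ℚ.* ev p c
      ≡⟨ solve 3 (λ a x y → x :- y := (a :+ x) :- (a :+ y)) refl a (q ℚ.* ev p q) (c ℚ.* ev p c) ⟩
    ev (a ∷ p) q ℚ.- ev (a ∷ p) c
      ≡⟨ cong₂ ℚ._-_ (trans (cong (λ k → ev (a ∷ p) (fromℕ k)) (ℕ.+-suc m N)) (roots (suc m))) (roots 0) ⟩
    0ℚ
      ≡⟨ ℚ.*-zeroʳ (fromℕ (suc m)) ⟨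
    fromℕ (suc m) ℚ.* 0ℚ ∎)
    where
    q = fromℕ (m ℕ.+ suc N)
    difference : fromℕ (suc m) ≡ q ℚ.- c
    difference = begin
      fromℕ (suc m)                          ≡⟨ solve 2 (λ x y → x := (x :+ y) :- y) refl (fromℕ (suc m)) c ⟩
      fromℕ (suc m) ℚ.+ c ℚ.- c              ≡⟨ cong (ℚ._- c) (fromℕ-+ (suc m) N) ⟨
      fromℕ (suc m ℕ.+ N) ℚ.- c              ≡⟨ cong (λ k → fromℕ k ℚ.- c) (ℕ.+-suc m N) ⟨
      q ℚ.- c                                ∎

coeff-+ : ∀ p r k → coeff (p + r) k ≡ coeff p k ℚ.+ coeff r k
coeff-+ []      r       k       = sym (ℚ.+-identityˡ (coeff r k))
coeff-+ (a ∷ p) []      k       = sym (ℚ.+-identityʳ (coeff (a ∷ p) k))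
coeff-+ (a ∷ p) (b ∷ r) zero    = refl
coeff-+ (a ∷ p) (b ∷ r) (suc k) = coeff-+ p r k

coeff-- : ∀ p k → coeff (- p) k ≡ ℚ.- coeff p k
coeff-- []      k       = refl
coeff-- (a ∷ p) zero    = refl
coeff-- (a ∷ p) (suc k) = coeff-- p k

ev-injective : ∀ p r → (∀ q → ev p q ≡ ev r q) → p ≈ r
ev-injective p r p≡r = mk≈ λ k → begin
  coeff p k                                        ≡⟨ solve 2 (λ x y → x := (x :+ (:- y)) :+ y) refl (coeff p k) (coeff r k) ⟩
  coeff p k ℚ.+ ℚ.- coeff r k ℚ.+ coeff r k        ≡⟨ cong (λ z → coeff p k ℚ.+ z ℚ.+ coeff r k) (coeff-- r k) ⟨
  coeff p k ℚ.+ coeff (- r) k ℚ.+ coeff r k        ≡⟨ cong (ℚ._+ coeff r k) (coeff-+ p (- r) k) ⟨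
  coeff (p - r) k ℚ.+ coeff r k                    ≡⟨ cong (ℚ._+ coeff r k) (vanishing⇒zero (length (p - r)) (p - r) ℕ.≤-refl 0 roots k) ⟩
  0ℚ ℚ.+ coeff r k                                 ≡⟨ ℚ.+-identityˡ (coeff r k) ⟩
  coeff r k                                        ∎
  where
  open +-*-Solver
  roots : ∀ m → ev (p - r) (fromℕ (m ℕ.+ 0)) ≡ 0ℚ
  roots m = begin
    ev (p - r) q                  ≡⟨ trans (ev-+ p (- r) q) (cong₂ ℚ._+_ (p≡r q) (ev-- r q)) ⟩
    ev r q ℚ.- ev r q             ≡⟨ ℚ.+-inverseʳ (ev r q) ⟩
    0ℚ                            ∎
    where q = fromℕ (m ℕ.+ 0)

-- Factorials and binomial coefficients at rational points

!/!-*-! : ∀ m n → (m !/ n !) ℚ.* fromℕ (n !) ≡ fromℕ (m !)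
!/!-*-! m n = /-*-cancel (m !) (n !) {{n ℕ.!≢0}}

*-cancelʳ-! : ∀ n {a b} → a ℚ.* fromℕ (n !) ≡ b ℚ.* fromℕ (n !) → a ≡ b
*-cancelʳ-! n {a} {b} eq = *-cancelˡ-fromℕ (n !) {{n ℕ.!≢0}}
  (trans (ℚ.*-comm (fromℕ (n !)) a) (trans eq (ℚ.*-comm b (fromℕ (n !)))))

0!/suc! : ∀ k → fromℕ (suc k) ℚ.* (0 !/ suc k !) ≡ 0 !/ k !
0!/suc! k = *-cancelʳ-! k (begin
  fromℕ (suc k) ℚ.* (0 !/ suc k !) ℚ.* fromℕ (k !)
    ≡⟨ solve 3 (λ n r f → n :* r :* f := r :* (n :* f)) refl (fromℕ (suc k)) (0 !/ suc k !) (fromℕ (k !)) ⟩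
  (0 !/ suc k !) ℚ.* (fromℕ (suc k) ℚ.* fromℕ (k !))
    ≡⟨ cong ((0 !/ suc k !) ℚ.*_) (fromℕ-* (suc k) (k !)) ⟨
  (0 !/ suc k !) ℚ.* fromℕ (suc k !)
    ≡⟨ trans (!/!-*-! 0 (suc k)) (sym (!/!-*-! 0 k)) ⟩
  (0 !/ k !) ℚ.* fromℕ (k !) ∎)
  where open +-*-Solver

-- The value is (β + 1)ₖ / k!. Holding β fixed while the lower index varies gives a family F that
-- obeys the recurrence of (1 - t)^(-β-1), even though α itself is tied to a single k.
ev-binom : ∀ β k α q → ev α q ≡ β ℚ.+ fromℕ k → ev (binom α (pos k)) q ≡ G (β ℚ.+ 1ℚ) k
ev-binom β k α q ev-α = begin
  ev (const (0 !/ k !) * product {k} (λ l → α - ⌜ toℕ l ⌝)) q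
    ≡⟨ trans (ev-* (const (0 !/ k !)) (product {k} (λ l → α - ⌜ toℕ l ⌝)) q)
         (cong₂ ℚ._*_ (ev-const (0 !/ k !) q) (trans (ev-product {k} (λ l → α - ⌜ toℕ l ⌝) q) (product-cong {k} (λ l → factor (toℕ l))))) ⟩
  F k
    ≡⟨ G-unique (β ℚ.+ 1ℚ) F refl F-suc k ⟩
  G (β ℚ.+ 1ℚ) k ∎
  where
  open +-*-Solver
  factor : ∀ l → ev (α - ⌜ l ⌝) q ≡ β ℚ.+ fromℕ k ℚ.- fromℕ l
  factor l = trans (ev-+ α (- ⌜ l ⌝) q) (cong₂ ℚ._+_ ev-α (trans (ev-- ⌜ l ⌝ q) (cong ℚ.-_ (ev-const (fromℕ l) q))))

  Π : ℕ → ℚ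
  Π k = ∏ {k} (λ l → β ℚ.+ fromℕ k ℚ.- fromℕ (toℕ l))

  F : ℕ → ℚ
  F k = (0 !/ k !) ℚ.* Π k

  F-suc : ∀ k → fromℕ (suc k) ℚ.* F (suc k) ≡ (β ℚ.+ 1ℚ ℚ.+ fromℕ k) ℚ.* F k
  F-suc k = begin
    fromℕ (suc k) ℚ.* ((0 !/ suc k !) ℚ.* ((β ℚ.+ fromℕ (suc k) ℚ.- 0ℚ) ℚ.* ∏ {k} (λ l → β ℚ.+ fromℕ (suc k) ℚ.- fromℕ (suc (toℕ l)))))
      ≡⟨ ℚ.*-assoc (fromℕ (suc k)) (0 !/ suc k !) _ ⟨
    fromℕ (suc k) ℚ.* (0 !/ suc k !) ℚ.* ((β ℚ.+ fromℕ (suc k) ℚ.- 0ℚ) ℚ.* ∏ {k} (λ l → β ℚ.+ fromℕ (suc k) ℚ.- fromℕ (suc (toℕ l))))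
      ≡⟨ cong₂ (λ y z → y ℚ.* ((β ℚ.+ fromℕ (suc k) ℚ.- 0ℚ) ℚ.* z)) (0!/suc! k) (product-cong {k} (λ l → shifted (toℕ l))) ⟩
    (0 !/ k !) ℚ.* ((β ℚ.+ fromℕ (suc k) ℚ.- 0ℚ) ℚ.* Π k)
      ≡⟨ cong (λ n → (0 !/ k !) ℚ.* ((β ℚ.+ n ℚ.- 0ℚ) ℚ.* Π k)) (fromℕ-suc k) ⟩
    (0 !/ k !) ℚ.* ((β ℚ.+ (1ℚ ℚ.+ fromℕ k) ℚ.- 0ℚ) ℚ.* Π k)
      ≡⟨ solve 4 (λ r β n z → r :* ((β :+ (con 1ℚ :+ n) :- con 0ℚ) :* z) := (β :+ con 1ℚ :+ n) :* (r :* z)) refl (0 !/ k !) β (fromℕ k) (Π k) ⟩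
    (β ℚ.+ 1ℚ ℚ.+ fromℕ k) ℚ.* F k ∎
    where
    shifted : ∀ l → β ℚ.+ fromℕ (suc k) ℚ.- fromℕ (suc l) ≡ β ℚ.+ fromℕ k ℚ.- fromℕ l
    shifted l = trans (cong₂ (λ m n → β ℚ.+ m ℚ.- n) (fromℕ-suc k) (fromℕ-suc l))
      (solve 3 (λ β k l → β :+ (con 1ℚ :+ k) :- (con 1ℚ :+ l) := β :+ k :- l) refl β (fromℕ k) (fromℕ l))

-- Solving the recurrence

∏-snoc : ∀ n (f : ℕ → ℚ) → ∏ {suc n} (λ k → f (toℕ k)) ≡ ∏ {n} (λ k → f (toℕ k)) ℚ.* f n
∏-snoc zero    f = ℚ.*-comm (f 0) 1ℚ
∏-snoc (suc n) f = trans (cong (f 0 ℚ.*_) (∏-snoc n (λ k → f (suc k)))) (sym (ℚ.*-assoc (f 0) _ (f (suc n))))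

∏-2* : ∀ n (f : Fin n → ℚ) → fromℕ (2 ^ n) ℚ.* ∏ f ≡ ∏ (λ i → fromℕ 2 ℚ.* f i)
∏-2* zero    f = refl
∏-2* (suc n) f = begin
  fromℕ (2 ^ suc n) ℚ.* (f zero ℚ.* ∏ (λ i → f (suc i)))
    ≡⟨ cong (ℚ._* (f zero ℚ.* ∏ (λ i → f (suc i)))) (fromℕ-* 2 (2 ^ n)) ⟩
  fromℕ 2 ℚ.* fromℕ (2 ^ n) ℚ.* (f zero ℚ.* ∏ (λ i → f (suc i)))
    ≡⟨ solve 4 (λ t p f g → t :* p :* (f :* g) := t :* f :* (p :* g)) refl (fromℕ 2) (fromℕ (2 ^ n)) (f zero) (∏ (λ i → f (suc i))) ⟩
  fromℕ 2 ℚ.* f zero ℚ.* (fromℕ (2 ^ n) ℚ.* ∏ (λ i → f (suc i)))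
    ≡⟨ cong (fromℕ 2 ℚ.* f zero ℚ.*_) (∏-2* n (λ i → f (suc i))) ⟩
  ∏ (λ i → fromℕ 2 ℚ.* f i) ∎
  where open +-*-Solver

∏-9 : ∀ n → ∏ {n} (λ _ → fromℕ 9) ≡ fromℕ (3 ^ n) ℚ.* fromℕ (3 ^ n)
∏-9 zero    = refl
∏-9 (suc n) = begin
  fromℕ 9 ℚ.* ∏ {n} (λ _ → fromℕ 9)
    ≡⟨ cong (fromℕ 9 ℚ.*_) (∏-9 n) ⟩
  fromℕ 9 ℚ.* (fromℕ (3 ^ n) ℚ.* fromℕ (3 ^ n))
    ≡⟨ solve 1 (λ z → con (fromℕ 9) :* (z :* z) := con (fromℕ 3) :* z :* (con (fromℕ 3) :* z)) refl (fromℕ (3 ^ n)) ⟩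
  fromℕ 3 ℚ.* fromℕ (3 ^ n) ℚ.* (fromℕ 3 ℚ.* fromℕ (3 ^ n))
    ≡⟨ cong₂ ℚ._*_ (fromℕ-* 3 (3 ^ n)) (fromℕ-* 3 (3 ^ n)) ⟨
  fromℕ (3 ^ suc n) ℚ.* fromℕ (3 ^ suc n) ∎
  where open +-*-Solver

double≡2* : ∀ n → double n ≡ 2 ℕ.* n
double≡2* zero    = refl
double≡2* (suc n) = cong suc (trans (cong suc (double≡2* n)) (sym (ℕ.+-suc n (n ℕ.+ 0))))

fromℕ-double : ∀ n → fromℕ (double n) ≡ fromℕ 2 ℚ.* fromℕ n
fromℕ-double n = trans (cong fromℕ (double≡2* n)) (fromℕ-* 2 n)

E : ℕ → ℚ
E n = ∏ {n} (λ j → fromℕ 3 ℚ.* oddℚ (toℕ j))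

-- E n is 3ⁿ (2n - 1)!!, and (2n)! = 2ⁿ n! (2n - 1)!!.
E-closed : ∀ n → E n ℚ.* (fromℕ (2 ^ n) ℚ.* fromℕ (n !)) ≡ fromℕ (3 ^ n) ℚ.* fromℕ (double n !)
E-closed zero    = refl
E-closed (suc n) = begin
  E (suc n) ℚ.* (fromℕ (2 ^ suc n) ℚ.* fromℕ (suc n !))
    ≡⟨ cong₂ ℚ._*_ (∏-snoc n (λ j → fromℕ 3 ℚ.* oddℚ j)) (cong₂ ℚ._*_ (fromℕ-* 2 (2 ^ n)) (fromℕ-* (suc n) (n !))) ⟩
  E n ℚ.* (fromℕ 3 ℚ.* oddℚ n) ℚ.* (fromℕ 2 ℚ.* fromℕ (2 ^ n) ℚ.* (fromℕ (suc n) ℚ.* fromℕ (n !)))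
    ≡⟨ solve 5 (λ e w p s f → e :* (con (fromℕ 3) :* w) :* (con (fromℕ 2) :* p :* (s :* f))
         := con (fromℕ 3) :* (e :* (p :* f)) :* ((con (fromℕ 2) :* s) :* w))
         refl (E n) (oddℚ n) (fromℕ (2 ^ n)) (fromℕ (suc n)) (fromℕ (n !)) ⟩
  fromℕ 3 ℚ.* (E n ℚ.* (fromℕ (2 ^ n) ℚ.* fromℕ (n !))) ℚ.* (fromℕ 2 ℚ.* fromℕ (suc n) ℚ.* oddℚ n)
    ≡⟨ cong₂ (λ y z → fromℕ 3 ℚ.* y ℚ.* (z ℚ.* oddℚ n)) (E-closed n) (sym (fromℕ-double (suc n))) ⟩
  fromℕ 3 ℚ.* (fromℕ (3 ^ n) ℚ.* fromℕ (double n !)) ℚ.* (fromℕ (double (suc n)) ℚ.* oddℚ n)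
    ≡⟨ solve 4 (λ t d e w → con (fromℕ 3) :* (t :* d) :* (e :* w) := con (fromℕ 3) :* t :* (e :* (w :* d)))
         refl (fromℕ (3 ^ n)) (fromℕ (double n !)) (fromℕ (double (suc n))) (oddℚ n) ⟩
  fromℕ 3 ℚ.* fromℕ (3 ^ n) ℚ.* (fromℕ (double (suc n)) ℚ.* (oddℚ n ℚ.* fromℕ (double n !)))
    ≡⟨ cong₂ ℚ._*_ (fromℕ-* 3 (3 ^ n)) (trans (fromℕ-* (double (suc n)) (suc (double n) !))
         (cong (fromℕ (double (suc n)) ℚ.*_) (fromℕ-* (suc (double n)) (double n !)))) ⟨
  fromℕ (3 ^ suc n) ℚ.* fromℕ (double (suc n) !) ∎
  where open +-*-Solver

-- By `E-closed`, E n is a factor of the positive natural number 3ⁿ (2n)!, so cancelling that number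
-- suffices.
E-cancelˡ : ∀ n {X Y} → E n ℚ.* X ≡ E n ℚ.* Y → X ≡ Y
E-cancelˡ n {X} {Y} EX≡EY = *-cancelˡ-fromℕ (double n !) {{double n ℕ.!≢0}} (*-cancelˡ-fromℕ (3 ^ n) {{ℕ.m^n≢0 3 n}}
  (trans (rearrange X) (trans (cong (c ℚ.*_) EX≡EY) (sym (rearrange Y)))))
  where
  open +-*-Solver
  c = fromℕ (2 ^ n) ℚ.* fromℕ (n !)
  rearrange : ∀ X → fromℕ (3 ^ n) ℚ.* (fromℕ (double n !) ℚ.* X) ≡ c ℚ.* (E n ℚ.* X)
  rearrange X = begin
    fromℕ (3 ^ n) ℚ.* (fromℕ (double n !) ℚ.* X)    ≡⟨ ℚ.*-assoc (fromℕ (3 ^ n)) (fromℕ (double n !)) X ⟨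
    fromℕ (3 ^ n) ℚ.* fromℕ (double n !) ℚ.* X      ≡⟨ cong (ℚ._* X) (E-closed n) ⟨
    E n ℚ.* c ℚ.* X                                 ≡⟨ solve 3 (λ e c x → e :* c :* x := c :* (e :* x)) refl (E n) c X ⟩
    c ℚ.* (E n ℚ.* X)                               ∎

factorialRatio : ℕ → ℚ
factorialRatio n = n !/ (2 ℕ.* n) !

E-factorialRatio : ∀ n → E n ℚ.* (fromℕ (2 ^ n) ℚ.* factorialRatio n) ≡ fromℕ (3 ^ n)
E-factorialRatio n = *-cancelʳ-! (2 ℕ.* n) (begin
  E n ℚ.* (fromℕ (2 ^ n) ℚ.* factorialRatio n) ℚ.* fromℕ ((2 ℕ.* n) !)
    ≡⟨ solve 4 (λ e p r f → e :* (p :* r) :* f := e :* (p :* (r :* f))) refl (E n) (fromℕ (2 ^ n)) (factorialRatio n) (fromℕ ((2 ℕ.* n) !)) ⟩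
  E n ℚ.* (fromℕ (2 ^ n) ℚ.* (factorialRatio n ℚ.* fromℕ ((2 ℕ.* n) !)))
    ≡⟨ cong (λ z → E n ℚ.* (fromℕ (2 ^ n) ℚ.* z)) (!/!-*-! n (2 ℕ.* n)) ⟩
  E n ℚ.* (fromℕ (2 ^ n) ℚ.* fromℕ (n !))
    ≡⟨ E-closed n ⟩
  fromℕ (3 ^ n) ℚ.* fromℕ (double n !)
    ≡⟨ cong (λ k → fromℕ (3 ^ n) ℚ.* fromℕ (k !)) (double≡2* n) ⟩
  fromℕ (3 ^ n) ℚ.* fromℕ ((2 ℕ.* n) !) ∎)
  where open +-*-Solver

prefactor : ℕ → ℚ
prefactor n = fromℕ (2 ^ ((n ℕ.+ 1) C 2)) ℚ.* fromℕ (3 ^ (n C 2)) ℚ.* ∏ {n} (λ k → factorialRatio (suc (toℕ k)))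

suc-C-2 : ∀ n → suc n C 2 ≡ n ℕ.+ n C 2
suc-C-2 n = trans (sym (nCk+nC[k+1]≡[n+1]C[k+1] n 1)) (cong (ℕ._+ n C 2) (nC1≡n n))

fromℕ-^-+ : ∀ b m n → fromℕ (b ^ (m ℕ.+ n)) ≡ fromℕ (b ^ m) ℚ.* fromℕ (b ^ n)
fromℕ-^-+ b m n = trans (cong fromℕ (ℕ.^-distribˡ-+-* b m n)) (fromℕ-* (b ^ m) (b ^ n))

prefactor-suc : ∀ n → prefactor (suc n) ≡ prefactor n ℚ.* (fromℕ (2 ^ suc n) ℚ.* fromℕ (3 ^ n) ℚ.* factorialRatio (suc n))
prefactor-suc n = begin
  prefactor (suc n)
    ≡⟨ cong₂ ℚ._*_ (cong₂ ℚ._*_ power₂ power₃) (∏-snoc n (λ k → factorialRatio (suc k))) ⟩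
  fromℕ (2 ^ suc n) ℚ.* p₂ ℚ.* (fromℕ (3 ^ n) ℚ.* p₃) ℚ.* (∏ {n} (λ k → factorialRatio (suc (toℕ k))) ℚ.* factorialRatio (suc n))
    ≡⟨ solve 6 (λ a p b q s r → a :* p :* (b :* q) :* (s :* r) := p :* q :* s :* (a :* b :* r)) refl
         (fromℕ (2 ^ suc n)) p₂ (fromℕ (3 ^ n)) p₃ (∏ {n} (λ k → factorialRatio (suc (toℕ k)))) (factorialRatio (suc n)) ⟩
  prefactor n ℚ.* (fromℕ (2 ^ suc n) ℚ.* fromℕ (3 ^ n) ℚ.* factorialRatio (suc n)) ∎
  where
  open +-*-Solver
  p₂ = fromℕ (2 ^ ((n ℕ.+ 1) C 2))
  p₃ = fromℕ (3 ^ (n C 2))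
  power₂ : fromℕ (2 ^ ((suc n ℕ.+ 1) C 2)) ≡ fromℕ (2 ^ suc n) ℚ.* p₂
  power₂ = trans (cong (λ k → fromℕ (2 ^ k)) (trans (suc-C-2 (n ℕ.+ 1)) (cong (ℕ._+ (n ℕ.+ 1) C 2) (ℕ.+-comm n 1))))
    (fromℕ-^-+ 2 (suc n) ((n ℕ.+ 1) C 2))
  power₃ : fromℕ (3 ^ (suc n C 2)) ≡ fromℕ (3 ^ n) ℚ.* p₃
  power₃ = trans (cong (λ k → fromℕ (3 ^ k)) (suc-C-2 n)) (fromℕ-^-+ 3 n (n C 2))

-- Passing from n to n + 1 multiplies `prefactor` by 2ⁿ⁺¹ 3ⁿ (n + 1)!/(2n + 2)!. The factor E (n +
-- 1) turns this into 3ⁿ · 3ⁿ⁺¹ = 3 · 9ⁿ, the constant of `D-recurrence`.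
E-prefactor : ∀ n → E (suc n) ℚ.* prefactor (suc n) ≡ fromℕ 3 ℚ.* (∏ {n} (λ _ → fromℕ 9) ℚ.* prefactor n)
E-prefactor n = begin
  E (suc n) ℚ.* prefactor (suc n)
    ≡⟨ cong (E (suc n) ℚ.*_) (prefactor-suc n) ⟩
  E (suc n) ℚ.* (prefactor n ℚ.* (fromℕ (2 ^ suc n) ℚ.* fromℕ (3 ^ n) ℚ.* factorialRatio (suc n)))
    ≡⟨ solve 5 (λ e c a b r → e :* (c :* (a :* b :* r)) := c :* b :* (e :* (a :* r))) refl
         (E (suc n)) (prefactor n) (fromℕ (2 ^ suc n)) (fromℕ (3 ^ n)) (factorialRatio (suc n)) ⟩
  prefactor n ℚ.* fromℕ (3 ^ n) ℚ.* (E (suc n) ℚ.* (fromℕ (2 ^ suc n) ℚ.* factorialRatio (suc n)))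
    ≡⟨ cong (prefactor n ℚ.* fromℕ (3 ^ n) ℚ.*_) (trans (E-factorialRatio (suc n)) (fromℕ-* 3 (3 ^ n))) ⟩
  prefactor n ℚ.* fromℕ (3 ^ n) ℚ.* (fromℕ 3 ℚ.* fromℕ (3 ^ n))
    ≡⟨ solve 2 (λ c t → c :* t :* (con (fromℕ 3) :* t) := con (fromℕ 3) :* (t :* t :* c)) refl (prefactor n) (fromℕ (3 ^ n)) ⟩
  fromℕ 3 ℚ.* (fromℕ (3 ^ n) ℚ.* fromℕ (3 ^ n) ℚ.* prefactor n)
    ≡⟨ cong (λ z → fromℕ 3 ℚ.* (z ℚ.* prefactor n)) (∏-9 n) ⟨
  fromℕ 3 ℚ.* (∏ {n} (λ _ → fromℕ 9) ℚ.* prefactor n) ∎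
  where open +-*-Solver

pochℚ : ℚ → ℕ → ℚ
pochℚ β n = ∏ {n} (λ k → β ℚ.+ fromℕ (toℕ k))

T : ℕ → ℚ → ℚ
T n a = ∏ {n} (λ k → pochℚ (a ℚ.+ fromℕ (3 ℕ.* toℕ k)) (n ∸ toℕ k))

T-suc : ∀ n a → T (suc n) a ≡ ∏ {suc n} (λ i → fromℕ (toℕ i) ℚ.+ a) ℚ.* T n (a +3)
T-suc n a = cong₂ ℚ._*_
  (product-cong {suc n} (λ i → solve 2 (λ a i → a :+ con 0ℚ :+ i := i :+ a) refl a (fromℕ (toℕ i))))
  (product-cong {n} (λ k → cong (λ β → pochℚ β (n ∸ toℕ k)) (argument (toℕ k))))
  where
  open +-*-Solver
  argument : ∀ k → a ℚ.+ fromℕ (3 ℕ.* suc k) ≡ a +3 ℚ.+ fromℕ (3 ℕ.* k)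
  argument k = trans (cong (a ℚ.+_) (trans (cong fromℕ (ℕ.*-suc 3 k)) (fromℕ-+ 3 (3 ℕ.* k))))
    (solve 2 (λ a k → a :+ (con (fromℕ 3) :+ k) := a :+ con 1ℚ :+ con 1ℚ :+ con 1ℚ :+ k) refl a (fromℕ (3 ℕ.* k)))

D-closed : ∀ n a → D n a ≡ prefactor n ℚ.* T n a
D-closed zero    a = refl
D-closed (suc n) a = E-cancelˡ (suc n) (begin
  E (suc n) ℚ.* D (suc n) a
    ≡⟨ D-recurrence n a ⟩
  ∏ {suc n} (λ i → fromℕ (toℕ i) ℚ.+ a) ℚ.* (fromℕ 3 ℚ.* (∏ {n} (λ _ → fromℕ 9) ℚ.* D n (a +3)))
    ≡⟨ cong (λ z → A ℚ.* (fromℕ 3 ℚ.* (∏ {n} (λ _ → fromℕ 9) ℚ.* z))) (D-closed n (a +3)) ⟩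
  A ℚ.* (fromℕ 3 ℚ.* (∏ {n} (λ _ → fromℕ 9) ℚ.* (prefactor n ℚ.* T n (a +3))))
    ≡⟨ solve 5 (λ p t n c u → p :* (t :* (n :* (c :* u))) := t :* (n :* c) :* (p :* u)) refl
         A (fromℕ 3) (∏ {n} (λ _ → fromℕ 9)) (prefactor n) (T n (a +3)) ⟩
  fromℕ 3 ℚ.* (∏ {n} (λ _ → fromℕ 9) ℚ.* prefactor n) ℚ.* (A ℚ.* T n (a +3))
    ≡⟨ cong₂ ℚ._*_ (E-prefactor n) (T-suc n a) ⟨
  E (suc n) ℚ.* prefactor (suc n) ℚ.* T (suc n) a
    ≡⟨ ℚ.*-assoc (E (suc n)) (prefactor (suc n)) (T (suc n) a) ⟩
  E (suc n) ℚ.* (prefactor (suc n) ℚ.* T (suc n) a) ∎)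
  where
  open +-*-Solver
  A = ∏ {suc n} (λ i → fromℕ (toℕ i) ℚ.+ a)

diagonal : ℕ → ℚ → ℚ
diagonal n a = ∏ {suc n} (λ k → a ℚ.+ fromℕ (3 ℕ.* toℕ k) ℚ.+ fromℕ (n ∸ toℕ k))

-- T is a triangle of linear factors that can be peeled in two ways. `T-suc` removes the whole
-- symbol for k = 0, as the recurrence in a + 3 demands; here the last factor of every Pochhammer
-- symbol is removed, which is what one more Gamma quotient contributes.
T-snoc : ∀ n a → T (suc n) a ≡ T n a ℚ.* diagonal n a
T-snoc n a = begin
  T (suc n) a
    ≡⟨ product-cong {suc n} (λ k → factor (toℕ k) (ℕ.s≤s⁻¹ (Fin.toℕ<n k))) ⟩
  ∏ {suc n} (λ k → f (toℕ k) ℚ.* (a ℚ.+ fromℕ (3 ℕ.* toℕ k) ℚ.+ fromℕ (n ∸ toℕ k)))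
    ≡⟨ product-distrib-* {suc n} (λ k → f (toℕ k)) (λ k → a ℚ.+ fromℕ (3 ℕ.* toℕ k) ℚ.+ fromℕ (n ∸ toℕ k)) ⟩
  ∏ {suc n} (λ k → f (toℕ k)) ℚ.* diagonal n a
    ≡⟨ cong (ℚ._* diagonal n a) (begin
         ∏ {suc n} (λ k → f (toℕ k))   ≡⟨ ∏-snoc n f ⟩
         -- For k = n the shortened symbol has length 0, so the extra factor is 1.
         T n a ℚ.* f n                 ≡⟨ cong (λ m → T n a ℚ.* pochℚ (a ℚ.+ fromℕ (3 ℕ.* n)) m) (ℕ.n∸n≡0 n) ⟩
         T n a ℚ.* 1ℚ                  ≡⟨ ℚ.*-identityʳ (T n a) ⟩
         T n a                         ∎) ⟩
  T n a ℚ.* diagonal n a ∎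
  where
  f : ℕ → ℚ
  f k = pochℚ (a ℚ.+ fromℕ (3 ℕ.* k)) (n ∸ k)
  factor : ∀ k → k ℕ.≤ n → pochℚ (a ℚ.+ fromℕ (3 ℕ.* k)) (suc n ∸ k) ≡ f k ℚ.* (a ℚ.+ fromℕ (3 ℕ.* k) ℚ.+ fromℕ (n ∸ k))
  factor k k≤n = trans (cong (pochℚ (a ℚ.+ fromℕ (3 ℕ.* k))) (ℕ.+-∸-assoc 1 k≤n))
    (∏-snoc (n ∸ k) (λ l → a ℚ.+ fromℕ (3 ℕ.* k) ℚ.+ fromℕ l))

-- The product of Gamma quotients

-- With i = n + 1, the factorials (i - 1)! and (2i - 1)! are i!/i and (2i)!/(2i), and the two
-- denominators leave a factor 2.
Γ-quotientℕ-factorialRatio : ∀ n → Γ-quotientℕ (suc n) (2 ℕ.* suc n) ≡ fromℕ 2 ℚ.* factorialRatio (suc n)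
Γ-quotientℕ-factorialRatio n = *-cancelʳ-! (2 ℕ.* suc n) (begin
  Γ ℚ.* fromℕ ((2 ℕ.* suc n) !)
    ≡⟨ cong (Γ ℚ.*_) (trans (fromℕ-* (2 ℕ.* suc n) (m !)) (cong (ℚ._* fromℕ (m !)) (fromℕ-* 2 (suc n)))) ⟩
  Γ ℚ.* (fromℕ 2 ℚ.* fromℕ (suc n) ℚ.* fromℕ (m !))
    ≡⟨ solve 4 (λ g t s f → g :* (t :* s :* f) := t :* (s :* (g :* f))) refl Γ (fromℕ 2) (fromℕ (suc n)) (fromℕ (m !)) ⟩
  fromℕ 2 ℚ.* (fromℕ (suc n) ℚ.* (Γ ℚ.* fromℕ (m !)))
    ≡⟨ cong (λ z → fromℕ 2 ℚ.* (fromℕ (suc n) ℚ.* z)) (!/!-*-! n m) ⟩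
  fromℕ 2 ℚ.* (fromℕ (suc n) ℚ.* fromℕ (n !))
    ≡⟨ cong (fromℕ 2 ℚ.*_) (trans (!/!-*-! (suc n) (2 ℕ.* suc n)) (fromℕ-* (suc n) (n !))) ⟨
  fromℕ 2 ℚ.* (factorialRatio (suc n) ℚ.* fromℕ ((2 ℕ.* suc n) !))
    ≡⟨ ℚ.*-assoc (fromℕ 2) (factorialRatio (suc n)) (fromℕ ((2 ℕ.* suc n) !)) ⟨
  fromℕ 2 ℚ.* factorialRatio (suc n) ℚ.* fromℕ ((2 ℕ.* suc n) !) ∎)
  where
  open +-*-Solver
  m = pred (2 ℕ.* suc n)
  Γ = Γ-quotientℕ (suc n) (2 ℕ.* suc n)

gammaFactor : ℚ → ℕ → ℚ
gammaFactor q k = fromℕ (2 ^ (2 ℕ.* suc k ∸ 1)) ℚ.* fromℕ (3 ^ k) ℚ.* Γ-quotientℕ (suc k) (2 ℕ.* suc k)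
  ℚ.* pochℚ (½ ℚ.* (fromℕ (suc k) ℚ.+ q)) (suc k)

-- With i = n + 1, the power 2²ⁱ⁻¹ and the 2 from the Gamma quotient combine to 2ⁱ · 2ⁱ. One copy
-- clears the halves in the i factors of the Pochhammer symbol, which become q + i + 2k = (q + 1) +
-- 3k + (n - k).
gammaFactor≡ : ∀ q n → gammaFactor q n ≡ (fromℕ (2 ^ suc n) ℚ.* fromℕ (3 ^ n) ℚ.* factorialRatio (suc n)) ℚ.* diagonal n (q ℚ.+ 1ℚ)
gammaFactor≡ q n = begin
  fromℕ (2 ^ m) ℚ.* fromℕ (3 ^ n) ℚ.* Γ-quotientℕ (suc n) (2 ℕ.* suc n) ℚ.* z
    ≡⟨ cong (λ g → fromℕ (2 ^ m) ℚ.* fromℕ (3 ^ n) ℚ.* g ℚ.* z) (Γ-quotientℕ-factorialRatio n) ⟩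
  fromℕ (2 ^ m) ℚ.* fromℕ (3 ^ n) ℚ.* (fromℕ 2 ℚ.* factorialRatio (suc n)) ℚ.* z
    ≡⟨ solve 5 (λ p t d r z → p :* t :* (d :* r) :* z := (d :* p) :* (t :* r :* z)) refl
         (fromℕ (2 ^ m)) (fromℕ (3 ^ n)) (fromℕ 2) (factorialRatio (suc n)) z ⟩
  fromℕ 2 ℚ.* fromℕ (2 ^ m) ℚ.* (fromℕ (3 ^ n) ℚ.* factorialRatio (suc n) ℚ.* z)
    ≡⟨ cong (ℚ._* (fromℕ (3 ^ n) ℚ.* factorialRatio (suc n) ℚ.* z)) (begin
         fromℕ 2 ℚ.* fromℕ (2 ^ m)                   ≡⟨ fromℕ-* 2 (2 ^ m) ⟨
         fromℕ (2 ^ (suc n ℕ.+ (suc n ℕ.+ 0)))       ≡⟨ cong (λ k → fromℕ (2 ^ (suc n ℕ.+ k))) (ℕ.+-identityʳ (suc n)) ⟩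
         fromℕ (2 ^ (suc n ℕ.+ suc n))               ≡⟨ fromℕ-^-+ 2 (suc n) (suc n) ⟩
         fromℕ (2 ^ suc n) ℚ.* fromℕ (2 ^ suc n)     ∎) ⟩
  fromℕ (2 ^ suc n) ℚ.* fromℕ (2 ^ suc n) ℚ.* (fromℕ (3 ^ n) ℚ.* factorialRatio (suc n) ℚ.* z)
    ≡⟨ solve 4 (λ p t r z → p :* p :* (t :* r :* z) := p :* t :* r :* (p :* z)) refl
         (fromℕ (2 ^ suc n)) (fromℕ (3 ^ n)) (factorialRatio (suc n)) z ⟩
  fromℕ (2 ^ suc n) ℚ.* fromℕ (3 ^ n) ℚ.* factorialRatio (suc n) ℚ.* (fromℕ (2 ^ suc n) ℚ.* z)
    ≡⟨ cong (fromℕ (2 ^ suc n) ℚ.* fromℕ (3 ^ n) ℚ.* factorialRatio (suc n) ℚ.*_)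
         (trans (∏-2* (suc n) (λ k → ½ ℚ.* (fromℕ (suc n) ℚ.+ q) ℚ.+ fromℕ (toℕ k)))
                (product-cong {suc n} (λ k → factor (toℕ k) (ℕ.s≤s⁻¹ (Fin.toℕ<n k))))) ⟩
  fromℕ (2 ^ suc n) ℚ.* fromℕ (3 ^ n) ℚ.* factorialRatio (suc n) ℚ.* diagonal n (q ℚ.+ 1ℚ) ∎
  where
  open +-*-Solver
  m = 2 ℕ.* suc n ∸ 1
  z = pochℚ (½ ℚ.* (fromℕ (suc n) ℚ.+ q)) (suc n)
  factor : ∀ k → k ℕ.≤ n → fromℕ 2 ℚ.* (½ ℚ.* (fromℕ (suc n) ℚ.+ q) ℚ.+ fromℕ k) ≡ q ℚ.+ 1ℚ ℚ.+ fromℕ (3 ℕ.* k) ℚ.+ fromℕ (n ∸ k)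
  factor k k≤n = begin
    fromℕ 2 ℚ.* (½ ℚ.* (fromℕ (suc n) ℚ.+ q) ℚ.+ fromℕ k)
      ≡⟨ cong (λ s → fromℕ 2 ℚ.* (½ ℚ.* (s ℚ.+ q) ℚ.+ fromℕ k))
           (trans (fromℕ-suc n) (cong (1ℚ ℚ.+_) (trans (cong fromℕ (sym (ℕ.m+[n∸m]≡n k≤n))) (fromℕ-+ k (n ∸ k))))) ⟩
    fromℕ 2 ℚ.* (½ ℚ.* (1ℚ ℚ.+ (fromℕ k ℚ.+ fromℕ (n ∸ k)) ℚ.+ q) ℚ.+ fromℕ k)
      ≡⟨ solve 3 (λ k d q → con (fromℕ 2) :* (con ½ :* (con 1ℚ :+ (k :+ d) :+ q) :+ k) := q :+ con 1ℚ :+ con (fromℕ 3) :* k :+ d)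
           refl (fromℕ k) (fromℕ (n ∸ k)) q ⟩
    q ℚ.+ 1ℚ ℚ.+ fromℕ 3 ℚ.* fromℕ k ℚ.+ fromℕ (n ∸ k)
      ≡⟨ cong (λ t → q ℚ.+ 1ℚ ℚ.+ t ℚ.+ fromℕ (n ∸ k)) (fromℕ-* 3 k) ⟨
    q ℚ.+ 1ℚ ℚ.+ fromℕ (3 ℕ.* k) ℚ.+ fromℕ (n ∸ k) ∎

∏-gammaFactor : ∀ n q → ∏ {n} (λ k → gammaFactor q (toℕ k)) ≡ prefactor n ℚ.* T n (q ℚ.+ 1ℚ)
∏-gammaFactor zero    q = refl
∏-gammaFactor (suc n) q = begin
  ∏ {suc n} (λ k → gammaFactor q (toℕ k))
    ≡⟨ ∏-snoc n (gammaFactor q) ⟩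
  ∏ {n} (λ k → gammaFactor q (toℕ k)) ℚ.* gammaFactor q n
    ≡⟨ cong₂ ℚ._*_ (∏-gammaFactor n q) (gammaFactor≡ q n) ⟩
  prefactor n ℚ.* T n a ℚ.* (s ℚ.* diagonal n a)
    ≡⟨ solve 4 (λ c t s d → c :* t :* (s :* d) := c :* s :* (t :* d)) refl (prefactor n) (T n a) s (diagonal n a) ⟩
  prefactor n ℚ.* s ℚ.* (T n a ℚ.* diagonal n a)
    ≡⟨ cong₂ ℚ._*_ (prefactor-suc n) (T-snoc n a) ⟨
  prefactor (suc n) ℚ.* T (suc n) a ∎
  where
  open +-*-Solver
  a = q ℚ.+ 1ℚ
  s = fromℕ (2 ^ suc n) ℚ.* fromℕ (3 ^ n) ℚ.* factorialRatio (suc n)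

ev-poch : ∀ α n q → ev (poch α n) q ≡ pochℚ (ev α q) n
ev-poch α n q = trans (ev-product {n} (λ k → α + ⌜ toℕ k ⌝) q)
  (product-cong {n} (λ k → trans (ev-+ α ⌜ toℕ k ⌝ q) (cong (ev α q ℚ.+_) (ev-const (fromℕ (toℕ k)) q))))

-- Evaluating the three expressions of the theorem

entry : ℕ → ℕ → ℚ[x]
entry i j = ⌜ 4 ^ i ⌝ * binom (x + ⌜ i ⌝ + ⌜ 2 ℕ.* j ℕ.+ 1 ⌝) (pos (2 ℕ.* j ℕ.+ 1))
          + binom (x - ⌜ i ⌝ + ⌜ 2 ℕ.* j ℕ.+ 1 ⌝) (pos (2 ℕ.* j ℕ.+ 1))

ev-entry : ∀ i j q → ev (entry i j) q ≡ odd (p (q ℚ.+ 1ℚ) i) j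
ev-entry i j q = begin
  ev (entry i j) q
    ≡⟨ trans (ev-+ (⌜ 4 ^ i ⌝ * binom α⁺ (pos k)) (binom α⁻ (pos k)) q)
         (cong (ℚ._+ ev (binom α⁻ (pos k)) q) (trans (ev-* ⌜ 4 ^ i ⌝ (binom α⁺ (pos k)) q)
           (cong (ℚ._* ev (binom α⁺ (pos k)) q) (ev-const (fromℕ (4 ^ i)) q)))) ⟩
  fromℕ (4 ^ i) ℚ.* ev (binom α⁺ (pos k)) q ℚ.+ ev (binom α⁻ (pos k)) q
    ≡⟨ cong₂ (λ y z → fromℕ (4 ^ i) ℚ.* y ℚ.+ z) (ev-binom (q ℚ.+ fromℕ i) k α⁺ q ev-α⁺) (ev-binom (q ℚ.- fromℕ i) k α⁻ q ev-α⁻) ⟩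
  fromℕ (4 ^ i) ℚ.* G (q ℚ.+ fromℕ i ℚ.+ 1ℚ) k ℚ.+ G (q ℚ.- fromℕ i ℚ.+ 1ℚ) k
    ≡⟨ cong₂ (λ y z → fromℕ (4 ^ i) ℚ.* G y k ℚ.+ G z k)
         (solve 2 (λ q i → q :+ i :+ con 1ℚ := q :+ con 1ℚ :+ i) refl q (fromℕ i))
         (solve 2 (λ q i → q :- i :+ con 1ℚ := q :+ con 1ℚ :- i) refl q (fromℕ i)) ⟩
  fromℕ (4 ^ i) ℚ.* G (q ℚ.+ 1ℚ ℚ.+ fromℕ i) k ℚ.+ G (q ℚ.+ 1ℚ ℚ.- fromℕ i) k
    ≡⟨ cong₂ ℚ._+_ (trans (at (u-G (q ℚ.+ 1ℚ) i) k) (const-* (fromℕ (4 ^ i)) (G (q ℚ.+ 1ℚ ℚ.+ fromℕ i)) k))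
         (at (v-G (q ℚ.+ 1ℚ) i) k) ⟨
  p (q ℚ.+ 1ℚ) i k
    ≡⟨ cong (p (q ℚ.+ 1ℚ) i) (trans (ℕ.+-comm (2 ℕ.* j) 1) (cong suc (sym (double≡2* j)))) ⟩
  odd (p (q ℚ.+ 1ℚ) i) j ∎
  where
  open +-*-Solver
  k = 2 ℕ.* j ℕ.+ 1
  α⁺ = x + ⌜ i ⌝ + ⌜ k ⌝
  α⁻ = x - ⌜ i ⌝ + ⌜ k ⌝
  ev-α⁺ : ev α⁺ q ≡ q ℚ.+ fromℕ i ℚ.+ fromℕ k
  ev-α⁺ = trans (ev-+ (x + ⌜ i ⌝) ⌜ k ⌝ q) (cong₂ ℚ._+_
    (trans (ev-+ x ⌜ i ⌝ q) (cong₂ ℚ._+_ (ev-x q) (ev-const (fromℕ i) q))) (ev-const (fromℕ k) q))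
  ev-α⁻ : ev α⁻ q ≡ q ℚ.- fromℕ i ℚ.+ fromℕ k
  ev-α⁻ = trans (ev-+ (x - ⌜ i ⌝) ⌜ k ⌝ q) (cong₂ ℚ._+_
    (trans (ev-+ x (- ⌜ i ⌝) q) (cong₂ ℚ._+_ (ev-x q) (trans (ev-- ⌜ i ⌝ q) (cong ℚ.-_ (ev-const (fromℕ i) q))))) (ev-const (fromℕ k) q))

ev-determinant : ∀ n q → ev (det {suc n} (λ i j → entry (toℕ i) (toℕ j))) q ≡ fromℕ 2 ℚ.* (prefactor (suc n) ℚ.* T (suc n) (q ℚ.+ 1ℚ))
ev-determinant n q = begin
  ev (det {suc n} (λ i j → entry (toℕ i) (toℕ j))) q
    ≡⟨ ev-det {suc n} (λ i j → entry (toℕ i) (toℕ j)) q ⟩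
  detℚ {suc n} (λ i j → ev (entry (toℕ i) (toℕ j)) q)
    ≡⟨ ℚDet.det-cong {suc n} _ _ (λ i j → ev-entry (toℕ i) (toℕ j) q) ⟩
  detℚ {suc n} (λ i j → odd (p (q ℚ.+ 1ℚ) (toℕ i)) (toℕ j))
    ≡⟨ det-p n (q ℚ.+ 1ℚ) ⟩
  fromℕ 2 ℚ.* D (suc n) (q ℚ.+ 1ℚ)
    ≡⟨ cong (fromℕ 2 ℚ.*_) (D-closed (suc n) (q ℚ.+ 1ℚ)) ⟩
  fromℕ 2 ℚ.* (prefactor (suc n) ℚ.* T (suc n) (q ℚ.+ 1ℚ)) ∎

gammaTerm : ℕ → ℚ[x]
gammaTerm k = let i = suc k in
  ⌜ 2 ^ (2 ℕ.* i ∸ 1) ⌝ * ⌜ 3 ^ (i ∸ 1) ⌝ * const (Γ-quotientℕ i (2 ℕ.* i))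
    * Γ-quotient ((⌜ 3 ℕ.* i ⌝ + x) /2) ((⌜ i ⌝ + x) /2) i ([3i+x]/2≈[i+x]/2+i i)

ev-gammaTerm : ∀ k q → ev (gammaTerm k) q ≡ gammaFactor q k
ev-gammaTerm k q = trans (ev-* (c₂ * c₃ * const γ) (poch z i) q) (cong₂ ℚ._*_
  (trans (ev-* (c₂ * c₃) (const γ) q) (cong₂ ℚ._*_
    (trans (ev-* c₂ c₃ q) (cong₂ ℚ._*_ (ev-const (fromℕ (2 ^ (2 ℕ.* i ∸ 1))) q) (ev-const (fromℕ (3 ^ k)) q)))
    (ev-const γ q)))
  (trans (ev-poch z i q) (cong (λ β → pochℚ β i) (trans (ev-* (const ½) (⌜ i ⌝ + x) q)
    (cong₂ ℚ._*_ (ev-const ½ q) (trans (ev-+ ⌜ i ⌝ x q) (cong₂ ℚ._+_ (ev-const (fromℕ i) q) (ev-x q))))))))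
  where
  i = suc k
  c₂ = ⌜ 2 ^ (2 ℕ.* i ∸ 1) ⌝
  c₃ = ⌜ 3 ^ k ⌝
  γ = Γ-quotientℕ i (2 ℕ.* i)
  z = (⌜ i ⌝ + x) /2

ev-gammaProduct : ∀ n q → ev (⌜ 2 ⌝ * product {n} (λ k → gammaTerm (toℕ k))) q ≡ fromℕ 2 ℚ.* (prefactor n ℚ.* T n (q ℚ.+ 1ℚ))
ev-gammaProduct n q = trans (ev-* ⌜ 2 ⌝ (product {n} (λ k → gammaTerm (toℕ k))) q) (cong₂ ℚ._*_ (ev-const (fromℕ 2) q)
  (trans (ev-product {n} (λ k → gammaTerm (toℕ k)) q)
    (trans (product-cong {n} (λ k → ev-gammaTerm (toℕ k) q)) (∏-gammaFactor n q))))

ev-pochhammerProduct : ∀ n q → ev (⌜ 2 ^ ((n ℕ.+ 1) C 2 ℕ.+ 1) ⌝ * ⌜ 3 ^ (n C 2) ⌝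
    * product {n} (λ k → const (factorialRatio (suc (toℕ k))))
    * product {n} (λ k → poch (x + ⌜ 3 ℕ.* toℕ k ⌝ + ⌜ 1 ⌝) (n ∸ toℕ k))) q
  ≡ fromℕ 2 ℚ.* (prefactor n ℚ.* T n (q ℚ.+ 1ℚ))
ev-pochhammerProduct n q = begin
  ev (p₂ * p₃ * Πr * Πpoch) q
    ≡⟨ trans (ev-* (p₂ * p₃ * Πr) Πpoch q) (cong₂ ℚ._*_
         (trans (ev-* (p₂ * p₃) Πr q) (cong₂ ℚ._*_
           (trans (ev-* p₂ p₃ q) (cong₂ ℚ._*_
             (trans (ev-const (fromℕ (2 ^ ((n ℕ.+ 1) C 2 ℕ.+ 1))) q) (fromℕ-^-+ 2 ((n ℕ.+ 1) C 2) 1))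
             (ev-const (fromℕ (3 ^ (n C 2))) q)))
           (trans (ev-product {n} (λ k → const (factorialRatio (suc (toℕ k)))) q) (product-cong {n} (λ k → ev-const (factorialRatio (suc (toℕ k))) q)))))
         (trans (ev-product {n} (λ k → poch (β (toℕ k)) (n ∸ toℕ k)) q) (product-cong {n} (λ k →
           trans (ev-poch (β (toℕ k)) (n ∸ toℕ k) q) (cong (λ b → pochℚ b (n ∸ toℕ k)) (ev-β (toℕ k))))))) ⟩
  fromℕ (2 ^ ((n ℕ.+ 1) C 2)) ℚ.* fromℕ 2 ℚ.* fromℕ (3 ^ (n C 2)) ℚ.* ∏ {n} (λ k → factorialRatio (suc (toℕ k))) ℚ.* T n (q ℚ.+ 1ℚ)
    ≡⟨ solve 5 (λ a d b s t → a :* d :* b :* s :* t := d :* (a :* b :* s :* t)) refl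
         (fromℕ (2 ^ ((n ℕ.+ 1) C 2))) (fromℕ 2) (fromℕ (3 ^ (n C 2))) (∏ {n} (λ k → factorialRatio (suc (toℕ k)))) (T n (q ℚ.+ 1ℚ)) ⟩
  fromℕ 2 ℚ.* (prefactor n ℚ.* T n (q ℚ.+ 1ℚ)) ∎
  where
  open +-*-Solver
  p₂ = ⌜ 2 ^ ((n ℕ.+ 1) C 2 ℕ.+ 1) ⌝
  p₃ = ⌜ 3 ^ (n C 2) ⌝
  Πr = product {n} (λ k → const (factorialRatio (suc (toℕ k))))
  β : ℕ → ℚ[x]
  β k = x + ⌜ 3 ℕ.* k ⌝ + ⌜ 1 ⌝
  Πpoch = product {n} (λ k → poch (β (toℕ k)) (n ∸ toℕ k))
  ev-β : ∀ k → ev (β k) q ≡ q ℚ.+ 1ℚ ℚ.+ fromℕ (3 ℕ.* k)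
  ev-β k = trans (ev-+ (x + ⌜ 3 ℕ.* k ⌝) ⌜ 1 ⌝ q) (trans (cong₂ ℚ._+_
    (trans (ev-+ x ⌜ 3 ℕ.* k ⌝ q) (cong₂ ℚ._+_ (ev-x q) (ev-const (fromℕ (3 ℕ.* k)) q))) (ev-const 1ℚ q))
    (solve 2 (λ q k → q :+ k :+ con 1ℚ := q :+ con 1ℚ :+ k) refl q (fromℕ (3 ℕ.* k))))

theorem15 : (n : ℕ) → n ≥ 1 →
    let
      determinant = det {n} (λ r s → let i = toℕ r in let j = toℕ s in
        ⌜ 4 ^ i ⌝ * binom (x + ⌜ i ⌝ + ⌜ 2 ℕ.* j ℕ.+ 1 ⌝) (pos (2 ℕ.* j ℕ.+ 1))
          + binom (x - ⌜ i ⌝ + ⌜ 2 ℕ.* j ℕ.+ 1 ⌝) (pos (2 ℕ.* j ℕ.+ 1)))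
      gammaProduct = ⌜ 2 ⌝ * product {n} (λ k → let i = suc (toℕ k) in
        ⌜ 2 ^ (2 ℕ.* i ∸ 1) ⌝ * ⌜ 3 ^ (i ∸ 1) ⌝ * const (Γ-quotientℕ i (2 ℕ.* i))
          * Γ-quotient ((⌜ 3 ℕ.* i ⌝ + x) /2) ((⌜ i ⌝ + x) /2) i ([3i+x]/2≈[i+x]/2+i i))
      pochhammerProduct = ⌜ 2 ^ ((n ℕ.+ 1) C 2 ℕ.+ 1) ⌝ * ⌜ 3 ^ (n C 2) ⌝
        * product {n} (λ k → let i = suc (toℕ k) in const (i !/ (2 ℕ.* i) !))
        * product {n} (λ k → let i = toℕ k in poch (x + ⌜ 3 ℕ.* i ⌝ + ⌜ 1 ⌝) (n ∸ i))
    in (determinant ≈ gammaProduct) × (gammaProduct ≈ pochhammerProduct)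
theorem15 (suc n) _ =
    ev-injective _ _ (λ q → trans (ev-determinant n q) (sym (ev-gammaProduct (suc n) q)))
  , ev-injective _ _ (λ q → trans (ev-gammaProduct (suc n) q) (sym (ev-pochhammerProduct (suc n) q)))
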